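{- There is an absolute constant $C>0$ such that the following holds. Let $G$ be a graph on $n+1$ vertices, and let $H$ be obtained from $G$ by deleting one vertex. Then $r(G) \leq C\sqrt{n\log n}\cdot r(H)$.
   Context: For a graph $F$, the Ramsey number $r(F)$ is the minimum $N$ such that every two-coloring of the edges of the complete graph $K_N$ contains a monochromatic copy of $F$. Logarithms are to base $2$.
   Formalization: The formal theorem assumes n ≥ 2: for n = 1 the right-hand side is 0 because log 1 = 0, while r(G) = 2, so the bound fails, and for n = 0 the logarithm is undefined. -}

module Defs where

open import Data.Bool.Base using (Bool)
open import Data.Fin.Base using (Fin; punchIn)
open import Data.Integer.Base using (+_; -[1+_])
open import Data.Nat.Base using (ℕ; suc; _≤_; _^_)
open import Data.Product.Base using (Σ-syntax; ∃-syntax; _×_)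
open import Data.Rational.Unnormalised.Base as ℚᵘ using (ℚᵘ; mkℚᵘ; 0ℚᵘ)
open import Data.Sum.Base using (_⊎_)
open import Function.Definitions using (Injective)
open import Level using (0ℓ)
open import Relation.Binary.Core using (Rel)
open import Relation.Binary.Definitions using (Symmetric; Irreflexive; Decidable)
open import Relation.Binary.PropositionalEquality.Core using (_≡_; refl)
open import Relation.Unary using (Pred; _∈_)

record Graph (n : ℕ) : Set₁ where
  field
    Adj    : Rel (Fin n) 0ℓ
    adj?   : Decidable Adj
    sym    : Symmetric Adj
    irrefl : Irreflexive _≡_ Adj

deleteVertex : ∀ {n} → Graph (suc n) → Fin (suc n) → Graph n
deleteVertex G v = record
  { Adj    = λ x y → Adj (punchIn v x) (punchIn v y)
  ; adj?   = λ x y → adj? (punchIn v x) (punchIn v y)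
  ; sym    = sym
  ; irrefl = λ { refl → irrefl refl }
  } where open Graph G

-- The values on the diagonal carry no information: a copy of a graph (below)
-- never looks at them, its vertex map being injective and its edges loop-free.
record TwoColoring (N : ℕ) : Set where
  field
    colour     : Fin N → Fin N → Bool
    colour-sym : ∀ x y → colour x y ≡ colour y x

-- Copies are not required to be induced.
MonochromaticCopy : ∀ {n N} → Graph n → TwoColoring N → Set
MonochromaticCopy {n} {N} F χ =
  Σ[ f ∈ (Fin n → Fin N) ] Injective _≡_ _≡_ f ×
  (∃[ c ] ∀ x y → Adj x y → colour (f x) (f y) ≡ c)
  where open Graph F; open TwoColoring χ

Arrows : ∀ {n} → ℕ → Graph n → Set
Arrows N F = (χ : TwoColoring N) → MonochromaticCopy F χ

-- r(F) = N.
IsRamseyNumber : ∀ {n} → Graph n → ℕ → Set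
IsRamseyNumber F N = Arrows N F × (∀ M → Arrows M F → N ≤ M)

-- A real number x is represented by its closed lower cut { q ∈ ℚ ∣ q ≤ x },
-- so that q ∈ x reads "q ≤ x".
Cut : Set₁
Cut = Pred ℚᵘ 0ℓ

fromℕ : ℕ → ℚᵘ
fromℕ k = + k ℚᵘ./ 1

-- Logarithm to base 2: for p ≥ 0 and d ≥ 1, p/d ≤ log₂ n iff 2ᵖ ≤ nᵈ; a
-- negative rational lies below log₂ n as soon as n ≥ 1.
-- (log₂ 0 is the empty cut, i.e. -∞.)
log₂ : ℕ → Cut
log₂ n (mkℚᵘ (+ p)    d-1) = 2 ^ p ≤ n ^ suc d-1
log₂ n (mkℚᵘ -[1+ _ ] d-1) = 1 ≤ n

-- Meaningful for x ≥ 0.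
√_ : Cut → Cut
(√ x) q = q ℚᵘ.≤ 0ℚᵘ ⊎ q ℚᵘ.* q ∈ x

-- The product of a rational c ≥ 0 with a real number.
_·_ : ℚᵘ → Cut → Cut
(c · x) q = ∃[ r ] r ∈ x × q ℚᵘ.≤ c ℚᵘ.* r

infixr 7 _·_
infix  8 √_

{-# OPTIONS --safe #-}
module Submission where

-- Let H = G - v and r = r(H), and suppose that a colouring of K_N, with N a large multiple
-- of K r and K ≈ √(n log n), has no monochromatic copy of G. A set of r vertices contains a
-- monochromatic copy of H, so the c-neighbourhood of one vertex and the (not c)-neighbourhood
-- of another share fewer than r vertices. By double counting some colour, call it bad, then
-- has all its degrees at most about 3r, and the other colour, call it good, has no copy of H
-- inside the good neighbourhood A of some vertex, |A| ≥ 192 K r.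
--
-- Such a copy nevertheless exists. The s vertices of H of degree at least 4K are placed on a
-- good clique, and the rest greedily, each having at most 4K · 4r bad vertices to avoid.
-- The clique comes from an argument of Erdős and Szemerédi: a random colouring shows
-- 2^e ≤ 2 rⁿ, where e ≥ 2sK is the number of edges of H, and so r ≥ (n + 1)^(2q) for
-- q = ⌊s / 24K⌋. If W ⊆ A is a good clique of fewer than s vertices, then half of A has at
-- most q bad neighbours in W; many vertices of A share these neighbours, and among them there
-- is a good clique of q + 1 vertices (there is no bad one of n + 1), which replaces them in W.

open import Data.Bool.Base using (Bool; true; false; not; _∧_; _∨_; if_then_else_)
open import Data.Bool.Properties as Bool using (not-¬; ¬-not; not-involutive; ∨-zeroʳ)
open import Data.Empty using (⊥; ⊥-elim)
open import Data.Fin.Base as Fin using (Fin; zero; suc; punchIn; punchOut; _↑ˡ_; _↑ʳ_; combine; remQuot; finToFun; funToFin)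
open import Data.Fin.Properties as Fin using (_≟_; any?; all?; suc-injective; punchIn-punchOut; punchOut-injective; remQuot-combine; combine-remQuot; combine-injective; finToFun-funToFin)
import Data.Integer.Base as ℤ
import Data.Integer.Properties as ℤ
open import Data.List.Base as List using (List; []; _∷_; _++_; length; filter; lookup; allFin; tabulate)
open import Data.List.Properties using (length-++; length-map; length-filter; length-tabulate)
open import Data.List.Membership.Propositional using () renaming (_∈_ to _∈ₗ_)
open import Data.List.Membership.Propositional.Properties using (∈-filter⁺; ∈-++⁺ˡ; ∈-++⁺ʳ; ∈-map⁺; ∈-allFin; ∈-lookup)
open import Data.List.Relation.Binary.Sublist.Propositional using (_⊆_; []; _∷_; _∷ʳ_; ⊆-refl)
open import Data.List.Relation.Binary.Sublist.Propositional.Properties using (All-resp-⊆)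
open import Data.List.Relation.Unary.All as All using (All; []; _∷_)
import Data.List.Relation.Unary.All.Properties as All
open import Data.List.Relation.Unary.AllPairs using (AllPairs; []; _∷_)
import Data.List.Relation.Unary.AllPairs.Properties as AllPairs
open import Data.List.Relation.Unary.Any using (here; there)
open import Data.Maybe.Base using (Maybe; just; nothing; is-just)
open import Data.Nat.Base
open import Data.Nat.DivMod using (m≡m%n+[m/n]*n; m%n<n)
open import Data.Nat.Properties as ℕ hiding (_≟_; suc-injective)
open import Data.Nat.Tactic.RingSolver using (solve-∀)
open import Data.Product.Base using (Σ-syntax; ∃-syntax; _×_; _,_; proj₁; proj₂)
open import Data.Rational.Unnormalised.Base using (ℚᵘ; 0ℚᵘ; *≤*; *<*)
import Data.Rational.Unnormalised.Base as ℚᵘ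
open import Data.Sum.Base using (_⊎_; inj₁; inj₂)
open import Data.Vec.Functional using (insertAt)
open import Data.Vec.Functional.Properties using (insertAt-lookup; insertAt-punchIn)
open import Function.Base using (_∘_)
open import Function.Definitions using (Injective)
open import Relation.Binary.Definitions using (Symmetric; tri<; tri≈; tri>)
open import Relation.Binary.PropositionalEquality
open import Relation.Nullary
open import Relation.Nullary.Decidable using (dec-true; dec-false; map′; decidable-stable)
open import Relation.Unary using (_∈_)
open import Defs

import Algebra.Properties.Semiring.Sum ℕ.+-*-semiring as ∑

-- Booleans, indicator sums and counting in finite sets

does-true⇒ : ∀ {a} {A : Set a} (A? : Dec A) → does A? ≡ true → A
does-true⇒ (yes a) _ = a

∧-true : ∀ {p q} → p ∧ q ≡ true → p ≡ true × q ≡ true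
∧-true {true} {true} _ = refl , refl

does-false⇒ : ∀ {a} {A : Set a} (A? : Dec A) → does A? ≡ false → ¬ A
does-false⇒ (no ¬a) _ = ¬a

not-true : ∀ {b} → not b ≡ true → b ≡ false
not-true {false} _ = refl

⟦_⟧ : Bool → ℕ
⟦ true  ⟧ = 1
⟦ false ⟧ = 0

⟦⟧≡0 : ∀ {b} → ⟦ b ⟧ ≡ 0 → b ≡ false
⟦⟧≡0 {false} _ = refl

⟦⟧-mono : ∀ p q → (p ≡ true → q ≡ true) → ⟦ p ⟧ ≤ ⟦ q ⟧
⟦⟧-mono false q     f = z≤n
⟦⟧-mono true  true  f = ≤-refl
⟦⟧-mono true  false f with () ← f refl

-- Opaque because unification cannot see through foldr on a vector of unknown length.
opaque
  sum : ∀ {N} → (Fin N → ℕ) → ℕ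
  sum = ∑.sum

  # : ∀ {N} → (Fin N → Bool) → ℕ
  # P = sum (λ i → ⟦ P i ⟧)

  #-unfold : ∀ {N} (P : Fin N → Bool) → # P ≡ sum (λ i → ⟦ P i ⟧)
  #-unfold P = refl

  sum-+ : ∀ {N} (f g : Fin N → ℕ) → sum (λ i → f i + g i) ≡ sum f + sum g
  sum-+ = ∑.∑-distrib-+

  sum-swap : ∀ {M N} (f : Fin M → Fin N → ℕ) →
             sum (λ i → sum (f i)) ≡ sum (λ j → sum (λ i → f i j))
  sum-swap = ∑.∑-comm

opaque
  unfolding sum #

  sum-mono : ∀ {N} {f g : Fin N → ℕ} → (∀ i → f i ≤ g i) → sum f ≤ sum g
  sum-mono {zero}  f≤g = z≤n
  sum-mono {suc N} f≤g = +-mono-≤ (f≤g zero) (sum-mono (f≤g ∘ suc))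

  sum-cong : ∀ {N} {f g : Fin N → ℕ} → (∀ i → f i ≡ g i) → sum f ≡ sum g
  sum-cong = ∑.sum-cong-≗

  sum-const : ∀ N m → sum {N} (λ _ → m) ≡ N * m
  sum-const zero    m = refl
  sum-const (suc N) m = cong (m +_) (sum-const N m)

  sum-*ʳ : ∀ {N} (f : Fin N → ℕ) m → sum (λ i → f i * m) ≡ sum f * m
  sum-*ʳ f m = sym (∑.*-distribʳ-sum m f)

  sum-≤ : ∀ {N} {f : Fin N → ℕ} {m} → (∀ i → f i ≤ m) → sum f ≤ N * m
  sum-≤ {N} {m = m} f≤m = ≤-trans (sum-mono f≤m) (≤-reflexive (sum-const N m))

  #-true : ∀ N → # {N} (λ _ → true) ≡ N
  #-true N = trans (sum-const N 1) (*-identityʳ N)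

  #-mono : ∀ {N} {P Q : Fin N → Bool} → (∀ i → P i ≡ true → Q i ≡ true) → # P ≤ # Q
  #-mono {P = P} {Q} P⊆Q = sum-mono (λ i → ⟦⟧-mono (P i) (Q i) (P⊆Q i))

  #-split : ∀ {N} (P Q : Fin N → Bool) →
            # P ≡ # (λ i → P i ∧ Q i) + # (λ i → P i ∧ not (Q i))
  #-split P Q = trans (sum-cong (λ i → split (P i) (Q i))) (sum-+ (λ i → ⟦ P i ∧ Q i ⟧) _)
    where
    split : ∀ p q → ⟦ p ⟧ ≡ ⟦ p ∧ q ⟧ + ⟦ p ∧ not q ⟧
    split false q     = refl
    split true  true  = refl
    split true  false = refl

  #-cover : ∀ {N} {P : Fin N → Bool} (Q R : Fin N → Bool) →
            (∀ i → P i ≡ true → Q i ≡ false → R i ≡ true) → # P ≤ # Q + # R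
  #-cover {P = P} Q R cover =
    ≤-trans (sum-mono (λ i → ind (P i) (Q i) (R i) (cover i))) (≤-reflexive (sum-+ (λ i → ⟦ Q i ⟧) _))
    where
    ind : ∀ p q r → (p ≡ true → q ≡ false → r ≡ true) → ⟦ p ⟧ ≤ ⟦ q ⟧ + ⟦ r ⟧
    ind false q     r f = z≤n
    ind true  true  r f = s≤s z≤n
    ind true  false r f = ⟦⟧-mono true r (λ _ → f refl refl)

  #-singleton : ∀ {N} (x : Fin N) → # (λ y → does (x ≟ y)) ≤ 1
  #-singleton {suc N} zero =
    s≤s (≤-trans (sum-≤ {N} {λ i → 0} {0} (λ _ → z≤n))
                 (≤-reflexive (*-zeroʳ N)))
  #-singleton {suc N} (suc x) =
    ≤-trans (#-mono {P = λ y → does (suc x ≟ suc y)} (λ _ eq → eq)) (#-singleton x)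

  markov : ∀ {N} (P : Fin N → Bool) {f : Fin N → ℕ} {m} →
           (∀ i → P i ≡ true → m ≤ f i) → # P * m ≤ sum f
  markov P {f} {m} m≤f = begin
    # P * m                     ≡⟨ sum-*ʳ (λ i → ⟦ P i ⟧) m ⟨
    sum (λ i → ⟦ P i ⟧ * m)     ≤⟨ sum-mono (λ i → ind (P i) (m≤f i)) ⟩
    sum f                       ∎
    where
    open ≤-Reasoning
    ind : ∀ p {k} → (p ≡ true → m ≤ k) → ⟦ p ⟧ * m ≤ k
    ind false _  = z≤n
    ind true  le = ≤-trans (≤-reflexive (*-identityˡ m)) (le refl)

  sum-weighted-≤ : ∀ {N} (P : Fin N → Bool) {f : Fin N → ℕ} {m} →
                   (∀ i → P i ≡ true → f i ≤ m) → sum (λ i → ⟦ P i ⟧ * f i) ≤ # P * m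
  sum-weighted-≤ P {f} {m} f≤m =
    ≤-trans (sum-mono (λ i → ind (P i) (f≤m i))) (≤-reflexive (sum-*ʳ (λ i → ⟦ P i ⟧) m))
    where
    ind : ∀ p {k} → (p ≡ true → k ≤ m) → ⟦ p ⟧ * k ≤ ⟦ p ⟧ * m
    ind false _  = z≤n
    ind true  le = *-monoʳ-≤ 1 (le refl)

  -- A sum below `# P` cannot have a positive term at every index of `P`. With `F` counting
  -- obstacles, this finds a free vertex.
  sum<#⇒∃0 : ∀ {N} {P : Fin N → Bool} {F : Fin N → ℕ} → sum F < # P →
             ∃[ i ] P i ≡ true × F i ≡ 0
  sum<#⇒∃0 {suc N} {P} {F} lt with P zero in p | F zero in f
  ... | true  | zero  = zero , p , f
  ... | true  | suc k with i , Pi , Fi ← sum<#⇒∃0 {P = P ∘ suc} {F ∘ suc}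
                             (≤-trans (s≤s (m≤n+m _ k)) (s≤s⁻¹ lt))
                      = suc i , Pi , Fi
  ... | false | k     with i , Pi , Fi ← sum<#⇒∃0 {P = P ∘ suc} {F ∘ suc} (≤-trans (s≤s (m≤n+m _ k)) lt)
                      = suc i , Pi , Fi

  #>0⇒∃ : ∀ {N} {P : Fin N → Bool} → 0 < # P → ∃[ i ] P i ≡ true
  #>0⇒∃ {N} {P} lt
    with i , Pi , _ ← sum<#⇒∃0 {P = P} {λ _ → 0}
                        (≤-trans (s≤s (≤-reflexive (trans (sum-const N 0) (*-zeroʳ N)))) lt)
    = i , Pi

  -- Turns a large subset into a copy of `Fin k`, so that `Arrows` can be applied inside it and
  -- edges can be indexed by numbers.
  enumerate : ∀ {N k} (P : Fin N → Bool) → k ≤ # P →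
              Σ[ f ∈ (Fin k → Fin N) ] Injective _≡_ _≡_ f × (∀ i → P (f i) ≡ true)
  enumerate {k = zero} P _ = (λ ()) , (λ {}) , λ ()
  enumerate {suc N} {suc k} P le with P zero in p
  ... | false with f , inj , Pf ← enumerate (P ∘ suc) le
              = suc ∘ f , inj ∘ suc-injective , Pf
  ... | true  with f , inj , Pf ← enumerate (P ∘ suc) (s≤s⁻¹ le)
              = g , g-inj , Pg
    where
    g : Fin (suc k) → Fin (suc N)
    g zero    = zero
    g (suc i) = suc (f i)
    g-inj : Injective _≡_ _≡_ g
    g-inj {zero}  {zero}  _  = refl
    g-inj {suc i} {suc j} eq = cong suc (inj (suc-injective eq))
    Pg : ∀ i → P (g i) ≡ true
    Pg zero    = p
    Pg (suc i) = Pf i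

  -- Induction on `k`: punching `f zero` out of the target lowers `# P` by exactly one and leaves an
  -- injection of the remaining indices.
  injection⇒≤# : ∀ {N k} {P : Fin N → Bool} {f : Fin k → Fin N} →
                 Injective _≡_ _≡_ f → (∀ i → P (f i) ≡ true) → k ≤ # P
  injection⇒≤# {k = zero} _ _ = z≤n
  injection⇒≤# {zero} {suc k} {f = f} _ _ with () ← f zero
  injection⇒≤# {suc N} {suc k} {P} {f} inj Pf = begin
    1 + k                                  ≤⟨ s≤s (injection⇒≤# g-inj Pg) ⟩
    1 + # (P ∘ punchIn (f zero))           ≡⟨ cong (λ b → ⟦ b ⟧ + # (P ∘ punchIn (f zero))) (Pf zero) ⟨
    ⟦ P (f zero) ⟧ + # (P ∘ punchIn (f zero)) ≡⟨ ∑.sum-remove {i = f zero} (λ i → ⟦ P i ⟧) ⟨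
    # P                                    ∎
    where
    open ≤-Reasoning
    f0≢ : ∀ j → f zero ≢ f (suc j)
    f0≢ j eq with () ← inj eq
    g : Fin k → Fin N
    g j = punchOut (f0≢ j)
    g-inj : Injective _≡_ _≡_ g
    g-inj eq = suc-injective (inj (punchOut-injective (f0≢ _) (f0≢ _) eq))
    Pg : ∀ j → P (punchIn (f zero) (g j)) ≡ true
    Pg j = trans (cong P (punchIn-punchOut (f0≢ j))) (Pf (suc j))

  sum-++ : ∀ m {n} (f : Fin (m + n) → ℕ) →
           sum f ≡ sum (λ i → f (i ↑ˡ n)) + sum (λ i → f (m ↑ʳ i))
  sum-++ zero    f = refl
  sum-++ (suc m) f = trans (cong (f zero +_) (sum-++ m (f ∘ suc))) (sym (+-assoc (f zero) _ _))

  sum-combine : ∀ m {n} (f : Fin (m * n) → ℕ) →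
                sum f ≡ sum {m} (λ x → sum {n} (λ y → f (combine x y)))
  sum-combine zero    f = refl
  sum-combine (suc m) {n} f =
    trans (sum-++ n f) (cong (sum (λ y → f (y ↑ˡ (m * n))) +_) (sum-combine m (f ∘ (n ↑ʳ_))))

  ≤-sum : ∀ {N} (f : Fin N → ℕ) i → f i ≤ sum f
  ≤-sum f zero    = m≤m+n _ _
  ≤-sum f (suc i) = ≤-trans (≤-sum (f ∘ suc) i) (m≤n+m _ (f zero))

  count : ∀ {A : Set} → (A → Bool) → List A → ℕ
  count P []       = 0
  count P (x ∷ xs) = ⟦ P x ⟧ + count P xs

  count-∷ : ∀ {A : Set} (P : A → Bool) x xs → count P (x ∷ xs) ≡ ⟦ P x ⟧ + count P xs
  count-∷ P x xs = refl

  count-tabulate : ∀ {n} {A : Set} (P : A → Bool) (g : Fin n → A) →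
                   count P (tabulate g) ≡ # (P ∘ g)
  count-tabulate {zero}  P g = refl
  count-tabulate {suc n} P g = cong (⟦ P (g zero) ⟧ +_) (count-tabulate P (g ∘ suc))

-- The probabilistic lower bound on Ramsey numbers

-- A partial bit string: `just b` prescribes a bit and `nothing` leaves it free.
Pattern : ℕ → Set
Pattern E = Fin E → Maybe Bool

Avoids : ∀ {E} → (Fin E → Bool) → Pattern E → Set
Avoids β p = ∃[ i ] p i ≡ just (not (β i))

choices : Maybe Bool → ℕ
choices nothing  = 2
choices (just _) = 1

-- The number of bit strings that match a pattern.
weight : ∀ {E} → Pattern E → ℕ
weight {zero}  p = 1
weight {suc E} p = choices (p zero) * weight (p ∘ suc)

opaque
  unfolding sum #

  -- Every prescribed bit halves the number of matching strings; the product form avoids division.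
  weight-* : ∀ {E} (p : Pattern E) → weight p * 2 ^ # (is-just ∘ p) ≡ 2 ^ E
  weight-* {zero}  p = refl
  weight-* {suc E} p with p zero
  ... | nothing = trans (*-assoc 2 (weight (p ∘ suc)) _) (cong (2 *_) (weight-* (p ∘ suc)))
  ... | just b  = begin
    1 * w * (2 * k)  ≡⟨ cong (_* (2 * k)) (*-identityˡ w) ⟩
    w * (2 * k)      ≡⟨ cong (w *_) (*-comm 2 k) ⟩
    w * (k * 2)      ≡⟨ *-assoc w k 2 ⟨
    w * k * 2        ≡⟨ *-comm (w * k) 2 ⟩
    2 * (w * k)      ≡⟨ cong (2 *_) (weight-* (p ∘ suc)) ⟩
    2 * 2 ^ E        ∎
    where
    open ≡-Reasoning
    w k : ℕ
    w = weight (p ∘ suc)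
    k = 2 ^ # (is-just ∘ p ∘ suc)

totalWeight : ∀ {E} → List (Pattern E) → ℕ
totalWeight []       = 0
totalWeight (p ∷ ps) = weight p + totalWeight ps

compatible : Bool → Maybe Bool → Bool
compatible b     nothing      = true
compatible true  (just c)     = c
compatible false (just c)     = not c

restrict : ∀ {E} → Bool → List (Pattern (suc E)) → List (Pattern E)
restrict b []       = []
restrict b (p ∷ ps) =
  if compatible b (p zero) then (p ∘ suc) ∷ restrict b ps else restrict b ps

-- The strings matching a pattern split according to their first bit: a free bit contributes to both
-- sides, a prescribed one only to its own.
totalWeight-restrict : ∀ {E} (ps : List (Pattern (suc E))) →
  totalWeight ps ≡ totalWeight (restrict true ps) + totalWeight (restrict false ps)
totalWeight-restrict [] = refl
totalWeight-restrict (p ∷ ps) with p zero | totalWeight-restrict ps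
... | nothing | eq = begin
  2 * w + totalWeight ps   ≡⟨ cong₂ _+_ (cong (w +_) (+-identityʳ w)) eq ⟩
  w + w + (a + b)          ≡⟨ +-assoc w w _ ⟩
  w + (w + (a + b))        ≡⟨ cong (w +_) (trans (cong (w +_) (+-comm a b)) (sym (+-assoc w b a))) ⟩
  w + (w + b + a)          ≡⟨ cong (w +_) (+-comm (w + b) a) ⟩
  w + (a + (w + b))        ≡⟨ +-assoc w a _ ⟨
  w + a + (w + b)          ∎
  where
  open ≡-Reasoning
  w = weight (p ∘ suc)
  a = totalWeight (restrict true ps)
  b = totalWeight (restrict false ps)
... | just true  | eq = trans (cong₂ _+_ (*-identityˡ w) eq) (sym (+-assoc w _ _))
  where w = weight (p ∘ suc)
... | just false | eq = begin
  1 * w + totalWeight ps   ≡⟨ cong₂ _+_ (*-identityˡ w) eq ⟩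
  w + (a + b)              ≡⟨ +-assoc w a b ⟨
  w + a + b                ≡⟨ cong (_+ b) (+-comm w a) ⟩
  a + w + b                ≡⟨ +-assoc a w b ⟩
  a + (w + b)              ∎
  where
  open ≡-Reasoning
  w = weight (p ∘ suc)
  a = totalWeight (restrict true ps)
  b = totalWeight (restrict false ps)

m+n<2k⇒m<k⊎n<k : ∀ m n k → m + n < 2 * k → m < k ⊎ n < k
m+n<2k⇒m<k⊎n<k m n k lt with m <? k
... | yes m<k = inj₁ m<k
... | no  m≮k with n <? k
...   | yes n<k = inj₂ n<k
...   | no  n≮k = ⊥-elim (<⇒≱ lt (+-mono-≤ (≮⇒≥ m≮k) (≤-trans (≤-reflexive (+-identityʳ k)) (≮⇒≥ n≮k))))

extend : ∀ {E} → Bool → (Fin E → Bool) → Fin (suc E) → Bool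
extend b β zero    = b
extend b β (suc i) = β i

-- A pattern dropped by `restrict` already clashes with `b` at the first position; the others clash
-- later.
extend-avoids : ∀ {E} b (β : Fin E → Bool) ps →
                All (Avoids β) (restrict b ps) → All (Avoids (extend b β)) ps
extend-avoids b β [] av = []
extend-avoids b β (p ∷ ps) av with p zero in p₀
extend-avoids b     β (p ∷ ps) ((i , q) ∷ av) | nothing = (suc i , q) ∷ extend-avoids b β ps av
extend-avoids true  β (p ∷ ps) ((i , q) ∷ av) | just true  = (suc i , q) ∷ extend-avoids true β ps av
extend-avoids true  β (p ∷ ps) av             | just false = (zero , p₀) ∷ extend-avoids true β ps av
extend-avoids false β (p ∷ ps) av             | just true  = (zero , p₀) ∷ extend-avoids false β ps av
extend-avoids false β (p ∷ ps) ((i , q) ∷ av) | just false = (suc i , q) ∷ extend-avoids false β ps av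

-- Method of conditional expectations: one of the two values of the first bit keeps the total weight
-- below `2 ^ E`. Once no bits remain, a surviving pattern would have weight 1, so none survives.
avoid : ∀ E (ps : List (Pattern E)) → totalWeight ps < 2 ^ E →
        Σ[ β ∈ (Fin E → Bool) ] All (Avoids β) ps
avoid zero    []       _  = (λ ()) , []
avoid zero    (p ∷ ps) (s≤s ())
avoid (suc E) ps       lt
  with m+n<2k⇒m<k⊎n<k _ _ (2 ^ E) (subst (_< 2 ^ suc E) (totalWeight-restrict ps) lt)
... | inj₁ lt′ with β , av ← avoid E (restrict true ps) lt′
    = extend true β , extend-avoids true β ps av
... | inj₂ lt′ with β , av ← avoid E (restrict false ps) lt′
    = extend false β , extend-avoids false β ps av

totalWeight-≤ : ∀ {E e} (ps : List (Pattern E)) → All (λ p → e ≤ # (is-just ∘ p)) ps →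
                totalWeight ps * 2 ^ e ≤ length ps * 2 ^ E
totalWeight-≤ []       []         = z≤n
totalWeight-≤ {E} {e} (p ∷ ps) (e≤ ∷ es) = begin
  (weight p + totalWeight ps) * 2 ^ e           ≡⟨ *-distribʳ-+ (2 ^ e) (weight p) _ ⟩
  weight p * 2 ^ e + totalWeight ps * 2 ^ e     ≤⟨ +-mono-≤ (*-monoʳ-≤ (weight p) (^-monoʳ-≤ 2 e≤)) (totalWeight-≤ ps es) ⟩
  weight p * 2 ^ # (is-just ∘ p) + length ps * 2 ^ E ≡⟨ cong (_+ length ps * 2 ^ E) (weight-* p) ⟩
  2 ^ E + length ps * 2 ^ E                     ∎
  where open ≤-Reasoning

-- The position of the bit that colours the unordered pair. Bits at positions `combine a b` with
-- `a > b` are never read, which is harmless since only the proportion of bad strings matters.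
pairIndex : ∀ {M} → Fin M → Fin M → Fin (M * M)
pairIndex a b with a Fin.≤? b
... | yes _ = combine a b
... | no  _ = combine b a

pairIndex-sym : ∀ {M} (a b : Fin M) → pairIndex a b ≡ pairIndex b a
pairIndex-sym a b with a Fin.≤? b | b Fin.≤? a
... | yes a≤b | yes b≤a = cong₂ combine (Fin.≤-antisym a≤b b≤a) (Fin.≤-antisym b≤a a≤b)
... | yes _   | no _    = refl
... | no _    | yes _   = refl
... | no a≰b  | no b≰a  = ⊥-elim (a≰b (<⇒≤ (≰⇒> b≰a)))

pairIndex-injective : ∀ {M} (a b c d : Fin M) → pairIndex a b ≡ pairIndex c d →
                (a ≡ c × b ≡ d) ⊎ (a ≡ d × b ≡ c)
pairIndex-injective a b c d eq with a Fin.≤? b | c Fin.≤? d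
... | yes _ | yes _ = inj₁ (combine-injective a b c d eq)
... | yes _ | no _  = inj₂ (combine-injective a b d c eq)
... | no _  | yes _ with b≡c , a≡d ← combine-injective b a c d eq = inj₂ (a≡d , b≡c)
... | no _  | no _  with b≡d , a≡c ← combine-injective b a d c eq = inj₁ (a≡c , b≡d)

module _ {n} (H : Graph n) where
  open Graph H renaming (sym to adj-sym)

  degree : Fin n → ℕ
  degree x = # (λ y → does (adj? x y))

  edge : Fin n → Fin n → Bool
  edge x y = does (adj? x y) ∧ does (x Fin.<? y)

  edgeCount : ℕ
  edgeCount = sum (λ x → # (edge x))

  edge⇒adj : ∀ {x y} → edge x y ≡ true → Adj x y
  edge⇒adj {x} {y} eq = does-true⇒ (adj? x y) (proj₁ (∧-true eq))

  edge⇒< : ∀ {x y} → edge x y ≡ true → x Fin.< y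
  edge⇒< {x} {y} eq = does-true⇒ (x Fin.<? y) (proj₂ (∧-true {does (adj? x y)} eq))

  -- Handshake lemma: every neighbour of `x` is joined to it by an edge oriented either out of `x`
  -- or into it.
  sum-degree-≤ : sum degree ≤ 2 * edgeCount
  sum-degree-≤ = begin
    sum degree                                       ≤⟨ sum-mono (λ x → #-cover (edge x) (λ y → edge y x) (cover x)) ⟩
    sum (λ x → # (edge x) + # (λ y → edge y x))      ≡⟨ sum-+ (λ x → # (edge x)) _ ⟩
    edgeCount + sum (λ x → # (λ y → edge y x))       ≡⟨ cong (edgeCount +_) swapped ⟩
    edgeCount + edgeCount                            ≡⟨ cong (edgeCount +_) (+-identityʳ edgeCount) ⟨
    2 * edgeCount                                    ∎
    where
    open ≤-Reasoning
    cover : ∀ x y → does (adj? x y) ≡ true → edge x y ≡ false → edge y x ≡ true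
    cover x y xy ¬e with does-true⇒ (adj? x y) xy
    ... | a with Fin.<-cmp x y
    ...   | tri< x<y _ _ with () ← trans (sym ¬e) (cong₂ _∧_ (dec-true (adj? x y) a) (dec-true (x Fin.<? y) x<y))
    ...   | tri≈ _ x≡y _ = ⊥-elim (irrefl x≡y a)
    ...   | tri> _ _ y<x = cong₂ _∧_ (dec-true (adj? y x) (adj-sym a)) (dec-true (y Fin.<? x) y<x)
    swapped : sum (λ x → # (λ y → edge y x)) ≡ edgeCount
    swapped = trans (sum-cong (λ x → #-unfold _)) (trans (sum-swap (λ x y → ⟦ edge y x ⟧)) (sum-cong (λ y → sym (#-unfold _))))

  edgeAt : Fin (n * n) → Bool
  edgeAt i = edge (proj₁ (remQuot {n} n i)) (proj₂ (remQuot {n} n i))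

  #-edgeAt : edgeCount ≡ # edgeAt
  #-edgeAt = begin
    sum (λ x → # (edge x))                                            ≡⟨ sum-cong (λ x → #-unfold (edge x)) ⟩
    sum (λ x → sum (λ y → ⟦ edge x y ⟧))                              ≡⟨ sum-cong (λ x → sum-cong (λ y → cong (λ (a , b) → ⟦ edge a b ⟧) (remQuot-combine x y))) ⟨
    sum (λ x → sum (λ y → ⟦ edgeAt (combine x y) ⟧))                  ≡⟨ sum-combine n (λ i → ⟦ edgeAt i ⟧) ⟨
    sum (λ i → ⟦ edgeAt i ⟧)                                          ≡⟨ #-unfold edgeAt ⟨
    # edgeAt                                                          ∎
    where open ≡-Reasoning

  module _ {M : ℕ} where

    EdgeTo : (Fin n → Fin M) → Fin (M * M) → Set
    EdgeTo f i = ∃[ x ] ∃[ y ] edge x y ≡ true × pairIndex (f x) (f y) ≡ i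

    edgeTo? : ∀ f i → Dec (EdgeTo f i)
    edgeTo? f i = any? λ x → any? λ y → (edge x y Bool.≟ true) ×-dec (pairIndex (f x) (f y) ≟ i)

    -- Matched by the colourings in which f carries every edge of H to colour c.
    copyPattern : Bool → (Fin n → Fin M) → Pattern (M * M)
    copyPattern c f i = if does (edgeTo? f i) then just c else nothing

    -- Distinct edges land on distinct positions: `f` is injective, and a collision with exchanged
    -- ends would contradict the orientation built into `edge`.
    edgeCount≤#pattern : ∀ c {f} → Injective _≡_ _≡_ f → edgeCount ≤ # (is-just ∘ copyPattern c f)
    edgeCount≤#pattern c {f} f-inj with g , g-inj , ge ← enumerate edgeAt (≤-reflexive #-edgeAt) =
      injection⇒≤# h-inj specified
      where
      X Y : Fin edgeCount → Fin n
      X k = proj₁ (remQuot {n} n (g k))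
      Y k = proj₂ (remQuot {n} n (g k))
      h : Fin edgeCount → Fin (M * M)
      h k = pairIndex (f (X k)) (f (Y k))
      h-inj : Injective _≡_ _≡_ h
      h-inj {k} {l} eq with pairIndex-injective _ _ _ _ eq
      ... | inj₁ (x≡x , y≡y) = g-inj (begin
        g k                 ≡⟨ combine-remQuot {n} n (g k) ⟨
        combine (X k) (Y k) ≡⟨ cong₂ combine (f-inj x≡x) (f-inj y≡y) ⟩
        combine (X l) (Y l) ≡⟨ combine-remQuot {n} n (g l) ⟩
        g l                 ∎)
        where open ≡-Reasoning
      ... | inj₂ (x≡y , y≡x) =
        ⊥-elim (<-asym (edge⇒< (ge k)) (subst₂ Fin._<_ (sym (f-inj y≡x)) (sym (f-inj x≡y)) (edge⇒< (ge l))))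
      specified : ∀ k → is-just (copyPattern c f (h k)) ≡ true
      specified k = cong (λ b → is-just (if b then just c else nothing))
                         (dec-true (edgeTo? f (h k)) (X k , Y k , ge k , refl))

    patterns : List (Pattern (M * M))
    patterns = List.map (λ j → copyPattern true (finToFun j)) (allFin (M ^ n))
            ++ List.map (λ j → copyPattern false (finToFun j)) (allFin (M ^ n))

    ∈-patterns : ∀ c j → copyPattern c (finToFun j) ∈ₗ patterns
    ∈-patterns true  j = ∈-++⁺ˡ (∈-map⁺ (λ j → copyPattern true (finToFun j)) (∈-allFin j))
    ∈-patterns false j = ∈-++⁺ʳ _ (∈-map⁺ (λ j → copyPattern false (finToFun j)) (∈-allFin j))

    length-patterns : length patterns ≡ 2 * M ^ n
    length-patterns = trans (length-++ (List.map _ (allFin (M ^ n)))) (cong₂ _+_ half (trans half (sym (+-identityʳ _))))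
      where
      half : ∀ {A : Set} {g : Fin (M ^ n) → A} → length (List.map g (allFin (M ^ n))) ≡ M ^ n
      half {g = g} = trans (length-map g (allFin (M ^ n))) (length-tabulate _)

  -- Union bound over all maps f and both colours.
  2^edgeCount≤ : ∀ {M} → Arrows M H → 2 ^ edgeCount ≤ 2 * M ^ n
  2^edgeCount≤ {M} arrows = ≮⇒≥ λ few → absurd (avoid (M * M) kept (light few))
    where
    open ≤-Reasoning
    full? : ∀ (p : Pattern (M * M)) → Dec (edgeCount ≤ # (is-just ∘ p))
    full? p = edgeCount ≤? # (is-just ∘ p)
    -- Among all maps, the non-injective ones may prescribe fewer than `edgeCount` bits and hence be
    -- too heavy. Discarding such patterns is safe, because copies come from injective maps.
    kept : List (Pattern (M * M))
    kept = filter full? (patterns {M})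
    light : 2 * M ^ n < 2 ^ edgeCount → totalWeight kept < 2 ^ (M * M)
    light few = *-cancelʳ-< (2 ^ edgeCount) _ _ (begin-strict
      totalWeight kept * 2 ^ edgeCount  ≤⟨ totalWeight-≤ kept (All.all-filter full? (patterns {M})) ⟩
      length kept * 2 ^ (M * M)         ≤⟨ *-monoˡ-≤ (2 ^ (M * M)) (length-filter full? (patterns {M})) ⟩
      length (patterns {M}) * 2 ^ (M * M)     ≡⟨ cong (_* 2 ^ (M * M)) (length-patterns {M}) ⟩
      2 * M ^ n * 2 ^ (M * M)           <⟨ *-monoˡ-< (2 ^ (M * M)) ⦃ m^n≢0 2 (M * M) ⦄ few ⟩
      2 ^ edgeCount * 2 ^ (M * M)       ≡⟨ *-comm (2 ^ edgeCount) _ ⟩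
      2 ^ (M * M) * 2 ^ edgeCount       ∎)
    absurd : (Σ[ β ∈ (Fin (M * M) → Bool) ] All (Avoids β) kept) → ⊥
    absurd (β , av)
      with f , f-inj , c , mono ← arrows (record { colour = λ a b → β (pairIndex a b) ; colour-sym = λ a b → cong β (pairIndex-sym a b) })
      = clash (All.lookup av (∈-filter⁺ full? (∈-patterns {M} c (funToFin f)) (edgeCount≤#pattern c f′-inj)))
      where
      -- The patterns are indexed by codes of maps, so `f` is replaced by the decoding of its code,
      -- with which it agrees pointwise.
      f′ : Fin n → Fin M
      f′ = finToFun (funToFin f)
      f′≗f : ∀ x → f′ x ≡ f x
      f′≗f = finToFun-funToFin f
      f′-inj : Injective _≡_ _≡_ f′
      f′-inj {x} {y} eq = f-inj (trans (sym (f′≗f x)) (trans eq (f′≗f y)))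
      clash : Avoids β (copyPattern c f′) → ⊥
      clash (i , eq) with edgeTo? f′ i
      clash (i , refl) | yes (x , y , e , at) =
        not-¬ refl (trans (cong β (trans (sym at) (cong₂ pairIndex (f′≗f x) (f′≗f y)))) (mono x y (edge⇒adj e)))
      clash (i , ()) | no _

-- Cliques and embeddings in graphs with few non-edges

-- Takes the place of Pascal's rule in the induction for `ramsey`.
^-pascal : ∀ k t → (2 + k) ^ t + suc k ^ suc t ≤ (2 + k) ^ suc t
^-pascal k t = begin
  (2 + k) ^ t + suc k * suc k ^ t     ≤⟨ +-monoʳ-≤ ((2 + k) ^ t) (*-monoʳ-≤ (suc k) (^-monoˡ-≤ t (n≤1+n (suc k)))) ⟩
  (2 + k) ^ t + suc k * (2 + k) ^ t   ∎
  where open ≤-Reasoning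

module Host {N} (R : Fin N → Fin N → Bool)
            (R-sym : ∀ {x y} → R x y ≡ true → R y x ≡ true)
            (R-irrefl : ∀ {x y} → R x y ≡ true → x ≢ y) where

  Clique Coclique : List (Fin N) → Set
  Clique   = AllPairs (λ x y → R x y ≡ true)
  Coclique = AllPairs (λ x y → x ≢ y × R x y ≡ false)

  _⊢_ : (Fin N → Bool) → List (Fin N) → Set
  X ⊢ xs = All (λ x → X x ≡ true) xs

  -- The Erdős-Szekeres recursion on the neighbours and non-neighbours of one vertex, with a power
  -- instead of a binomial coefficient. It is applied with `t = q` small and `k = n`.
  ramsey : ∀ t k X → suc k ^ t ≤ # X →
           (∃[ xs ] length xs ≡ suc t × X ⊢ xs × Clique xs) ⊎
           (∃[ xs ] length xs ≡ suc k × X ⊢ xs × Coclique xs)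
  ramsey t k X le with #>0⇒∃ {P = X} (≤-trans (m^n>0 (suc k) t) le)
  ramsey zero    k       X le | x , Xx = inj₁ (x ∷ [] , refl , Xx ∷ [] , [] ∷ [])
  ramsey (suc t) zero    X le | x , Xx = inj₂ (x ∷ [] , refl , Xx ∷ [] , [] ∷ [])
  ramsey (suc t) (suc k) X le | x , Xx = go (suc (suc k) ^ t ≤? # Y) (suc k ^ suc t ≤? # Z)
    where
    Y Z : Fin N → Bool
    Y y = X y ∧ R x y
    Z y = (X y ∧ not (R x y)) ∧ not (does (x ≟ y))
    Y⇒ : ∀ {y} → Y y ≡ true → X y ≡ true × R x y ≡ true
    Y⇒ = ∧-true
    Z⇒ : ∀ {y} → Z y ≡ true → X y ≡ true × x ≢ y × R x y ≡ false
    Z⇒ {y} eq with XR , x≢ ← ∧-true {X y ∧ not (R x y)} eq =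
      proj₁ (∧-true XR) , does-false⇒ (x ≟ y) (not-true x≢) , not-true (proj₂ (∧-true {X y} XR))
    total : # X ≤ # Y + (1 + # Z)
    total = begin
      # X                                    ≡⟨ #-split X (R x) ⟩
      # Y + # (λ y → X y ∧ not (R x y))      ≤⟨ +-monoʳ-≤ (# Y) (#-cover (λ y → does (x ≟ y)) Z (λ y p q → cong₂ _∧_ p (cong not q))) ⟩
      # Y + (# (λ y → does (x ≟ y)) + # Z)   ≤⟨ +-monoʳ-≤ (# Y) (+-monoˡ-≤ (# Z) (#-singleton x)) ⟩
      # Y + (1 + # Z)                        ∎
      where open ≤-Reasoning
    go : Dec (suc (suc k) ^ t ≤ # Y) → Dec (suc k ^ suc t ≤ # Z) →
         (∃[ xs ] length xs ≡ 2 + t × X ⊢ xs × Clique xs) ⊎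
         (∃[ xs ] length xs ≡ 2 + k × X ⊢ xs × Coclique xs)
    go (yes big) _ with ramsey t (suc k) Y big
    ... | inj₁ (xs , len , Yxs , cl) =
      inj₁ (x ∷ xs , cong suc len , Xx ∷ All.map (proj₁ ∘ Y⇒) Yxs , All.map (proj₂ ∘ Y⇒) Yxs ∷ cl)
    ... | inj₂ (xs , len , Yxs , co) = inj₂ (xs , len , All.map (proj₁ ∘ Y⇒) Yxs , co)
    go (no _) (yes big) with ramsey (suc t) k Z big
    ... | inj₁ (xs , len , Zxs , cl) = inj₁ (xs , len , All.map (proj₁ ∘ Z⇒) Zxs , cl)
    ... | inj₂ (xs , len , Zxs , co) =
      inj₂ (x ∷ xs , cong suc len , Xx ∷ All.map (proj₁ ∘ Z⇒) Zxs , All.map (proj₂ ∘ Z⇒) Zxs ∷ co)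
    -- Only `x` lies outside both `Y` and `Z`, and one of the two strict inequalities pays for it.
    go (no small₁) (no small₂) = ⊥-elim (<-irrefl refl (begin-strict
      # X                                     ≤⟨ total ⟩
      # Y + suc (# Z)                         <⟨ +-mono-<-≤ (≰⇒> small₁) (≰⇒> small₂) ⟩
      (2 + k) ^ t + suc k ^ suc t             ≤⟨ ^-pascal k t ⟩
      (2 + k) ^ suc t                         ≤⟨ le ⟩
      # X                                     ∎))
      where open ≤-Reasoning

  misses : Fin N → List (Fin N) → ℕ
  misses x []       = 0
  misses x (w ∷ ws) = ⟦ not (R x w) ⟧ + misses x ws

  misses≤0⇒All : ∀ {x} W → misses x W ≤ 0 → All (λ w → R x w ≡ true) W
  misses≤0⇒All []              _  = []
  misses≤0⇒All {x} (w ∷ W) le with R x w in eq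
  ... | true = eq ∷ misses≤0⇒All W le

  -- Few sets of at most q elements can be missed, so many vertices of X miss nothing
  -- outside the same one.
  common-neighbours : ∀ q W X m → m * suc (length W) ^ q ≤ # X →
    (∀ x → X x ≡ true → misses x W ≤ q) →
    ∃[ W′ ] W′ ⊆ W × length W ≤ q + length W′ ×
    ∃[ X′ ] m ≤ # X′ × (∀ x → X′ x ≡ true → X x ≡ true × All (λ w → R x w ≡ true) W′)
  common-neighbours zero W X m le few =
    W , ⊆-refl , ≤-refl , X , subst (_≤ # X) (*-identityʳ m) le ,
    λ x Xx → Xx , misses≤0⇒All W (few x Xx)
  common-neighbours (suc q) [] X m le few =
    [] , [] , z≤n , X , subst (_≤ # X) (trans (cong (m *_) (^-zeroˡ (suc q))) (*-identityʳ m)) le ,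
    λ x Xx → Xx , []
  common-neighbours (suc q) (w ∷ W) X m le few = go (m * suc ℓ ^ suc q ≤? # Y) (m * suc ℓ ^ q ≤? # Z)
    where
    ℓ = length W
    Y Z : Fin N → Bool
    Y x = X x ∧ R x w
    Z x = X x ∧ not (R x w)
    few-Y : ∀ x → Y x ≡ true → misses x W ≤ suc q
    few-Y x Yx = m+n≤o⇒n≤o ⟦ not (R x w) ⟧ (few x (proj₁ (∧-true Yx)))
    few-Z : ∀ x → Z x ≡ true → misses x W ≤ q
    few-Z x Zx with Xx , ¬R ← ∧-true {X x} Zx =
      s≤s⁻¹ (subst (λ b → ⟦ b ⟧ + misses x W ≤ suc q) ¬R (few x Xx))
    -- Either many vertices of `X` are joined to `w`, which is then kept, or many miss it, and
    -- dropping `w` uses up one of the allowed misses.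
    go : Dec (m * suc ℓ ^ suc q ≤ # Y) → Dec (m * suc ℓ ^ q ≤ # Z) → _
    go (yes big) _ with W′ , sub , long , X′ , m≤ , X′⇒ ← common-neighbours (suc q) W Y m big few-Y =
      w ∷ W′ , refl ∷ sub , ≤-trans (s≤s long) (≤-reflexive (sym (+-suc (suc q) (length W′)))) , X′ , m≤ ,
      λ x X′x → let Yx , aR = X′⇒ x X′x in proj₁ (∧-true Yx) , proj₂ (∧-true {X x} Yx) ∷ aR
    go (no _) (yes big) with W′ , sub , long , X′ , m≤ , X′⇒ ← common-neighbours q W Z m big few-Z =
      W′ , w ∷ʳ sub , s≤s long , X′ , m≤ ,
      λ x X′x → let Zx , aR = X′⇒ x X′x in proj₁ (∧-true Zx) , aR
    go (no small₁) (no small₂) = ⊥-elim (<-irrefl refl (begin-strict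
      # X                                        ≡⟨ #-split X (λ x → R x w) ⟩
      # Y + # Z                                  <⟨ +-mono-< (≰⇒> small₁) (≰⇒> small₂) ⟩
      m * suc ℓ ^ suc q + m * suc ℓ ^ q          ≡⟨ *-distribˡ-+ m (suc ℓ ^ suc q) _ ⟨
      m * (suc ℓ * suc ℓ ^ q + suc ℓ ^ q)        ≡⟨ cong (m *_) (+-comm (suc ℓ * suc ℓ ^ q) _) ⟩
      m * ((2 + ℓ) * suc ℓ ^ q)                  ≤⟨ *-monoʳ-≤ m (*-monoʳ-≤ (2 + ℓ) (^-monoˡ-≤ q (n≤1+n (suc ℓ)))) ⟩
      m * (2 + ℓ) ^ suc q                        ≤⟨ le ⟩
      # X                                        ∎))
      where open ≤-Reasoning

  Clique-resp-⊆ : ∀ {xs ys} → xs ⊆ ys → Clique ys → Clique xs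
  Clique-resp-⊆ []         []       = []
  Clique-resp-⊆ (y ∷ʳ s)   (_ ∷ cl) = Clique-resp-⊆ s cl
  Clique-resp-⊆ (refl ∷ s) (a ∷ cl) = All-resp-⊆ s a ∷ Clique-resp-⊆ s cl

  module Sparse (A : Fin N → Bool) (Δ k : ℕ)
                (sparse : ∀ w → # (λ z → not (R z w)) ≤ Δ)
                (no-coclique : ∀ xs → Coclique xs → length xs ≢ suc k) where

    sum-misses : ∀ W → sum (λ x → misses x W) ≤ length W * Δ
    sum-misses []      = ≤-trans (sum-≤ {m = 0} (λ _ → z≤n)) (≤-reflexive (*-zeroʳ N))
    sum-misses (w ∷ W) = begin
      sum (λ x → ⟦ not (R x w) ⟧ + misses x W)      ≡⟨ sum-+ (λ x → ⟦ not (R x w) ⟧) _ ⟩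
      sum (λ x → ⟦ not (R x w) ⟧) + sum (λ x → misses x W) ≡⟨ cong (_+ sum (λ x → misses x W)) (#-unfold _) ⟨
      # (λ x → not (R x w)) + sum (λ x → misses x W) ≤⟨ +-mono-≤ (sparse w) (sum-misses W) ⟩
      Δ + length W * Δ                              ∎
      where open ≤-Reasoning

    -- Averaging over A makes half of it miss at most q vertices of W; a clique of size
    -- q + 1 among those with the same missed set then replaces these.
    enlarge : ∀ q W → A ⊢ W → Clique W →
              2 * (length W * Δ) ≤ suc q * # A →
              2 * (suc k ^ q * suc (length W) ^ q) ≤ # A →
              ∃[ W′ ] A ⊢ W′ × Clique W′ × length W < length W′
    enlarge q W AW clW h₁ h₂ = finish (common-neighbours q W X (suc k ^ q) X-big X-few)
      where
      open ≤-Reasoning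
      many : Fin N → Bool
      many x = does (suc q ≤? misses x W)
      X : Fin N → Bool
      X x = A x ∧ not (many x)
      X-few : ∀ x → X x ≡ true → misses x W ≤ q
      X-few x Xx = s≤s⁻¹ (≰⇒> (does-false⇒ (suc q ≤? misses x W) (not-true (proj₂ (∧-true {A x} Xx)))))
      -- Markov's inequality: by `sum-misses` and `h₁`, at most `# A / 2` vertices of the whole host
      -- miss more than `q` elements of `W`.
      2many≤ : 2 * # many ≤ # A
      2many≤ = *-cancelˡ-≤ (suc q) (begin
        suc q * (2 * # many)   ≡⟨ *-comm (suc q) _ ⟩
        2 * # many * suc q     ≡⟨ *-assoc 2 (# many) _ ⟩
        2 * (# many * suc q)   ≤⟨ *-monoʳ-≤ 2 (markov many (λ x → does-true⇒ (suc q ≤? misses x W))) ⟩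
        2 * sum (λ x → misses x W) ≤⟨ *-monoʳ-≤ 2 (sum-misses W) ⟩
        2 * (length W * Δ)     ≤⟨ h₁ ⟩
        suc q * # A            ∎)
      A≤ : # A ≤ # many + # X
      A≤ = #-cover many X (λ x Ax ¬m → cong₂ _∧_ Ax (cong not ¬m))
      A≤2X : # A ≤ 2 * # X
      A≤2X = +-cancelˡ-≤ (# A) _ _ (begin
        # A + # A               ≡⟨ cong (# A +_) (+-identityʳ (# A)) ⟨
        2 * # A                 ≤⟨ *-monoʳ-≤ 2 A≤ ⟩
        2 * (# many + # X)      ≡⟨ *-distribˡ-+ 2 (# many) _ ⟩
        2 * # many + 2 * # X    ≤⟨ +-monoˡ-≤ _ 2many≤ ⟩
        # A + 2 * # X           ∎)
      X-big : suc k ^ q * suc (length W) ^ q ≤ # X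
      X-big = *-cancelˡ-≤ 2 (≤-trans h₂ A≤2X)
      finish : _ → ∃[ W′ ] A ⊢ W′ × Clique W′ × length W < length W′
      finish (W′ , sub , long , X′ , big , X′⇒) with ramsey q k X′ big
      ... | inj₂ (ys , len , _ , co) = ⊥-elim (no-coclique ys co len)
      ... | inj₁ (ys , len , X′ys , cl) =
        -- At most `q` elements of `W` are lost and `q + 1` are gained; the new ones lie in `X′` and
        -- so are joined to all of `W′`.
        ys ++ W′ ,
        All.++⁺ (All.map (proj₁ ∘ ∧-true ∘ proj₁ ∘ X′⇒ _) X′ys) (All-resp-⊆ sub AW) ,
        AllPairs.++⁺ cl (Clique-resp-⊆ sub clW) (All.map (proj₂ ∘ X′⇒ _) X′ys) ,
        (begin
          suc (length W)            ≤⟨ s≤s long ⟩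
          suc q + length W′         ≡⟨ cong (_+ length W′) len ⟨
          length ys + length W′     ≡⟨ length-++ ys ⟨
          length (ys ++ W′)         ∎)

    -- Iterates `enlarge`, gaining at least one vertex each time. The hypotheses at `s` cover every
    -- clique with `length W < s`; in particular `s ^ q` bounds `suc (length W) ^ q`.
    large-clique : ∀ q s → 2 * (s * Δ) ≤ suc q * # A → 2 * (suc k ^ q * s ^ q) ≤ # A →
                   ∀ j → j ≤ s → ∃[ W ] A ⊢ W × Clique W × j ≤ length W
    large-clique q s h₁ h₂ zero    _   = [] , [] , [] , z≤n
    large-clique q s h₁ h₂ (suc j) j<s
      with W , AW , cl , j≤ ← large-clique q s h₁ h₂ j (<⇒≤ j<s) | s ≤? length W
    ... | yes s≤ = W , AW , cl , ≤-trans j<s s≤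
    ... | no  s≰ with W<s ← ≰⇒> s≰
                 with W′ , AW′ , cl′ , lt ← enlarge q W AW cl
                        (≤-trans (*-monoʳ-≤ 2 (*-monoˡ-≤ Δ (<⇒≤ W<s))) h₁)
                        (≤-trans (*-monoʳ-≤ 2 (*-monoʳ-≤ (suc k ^ q) (^-monoˡ-≤ q W<s))) h₂)
                 = W′ , AW′ , cl′ , ≤-trans (s≤s j≤) lt

  module Embed {n} (H : Graph n) (A : Fin N → Bool) where
    open Graph H renaming (sym to adj-sym)

    -- A partial embedding with domain `P`; the values of `f` outside `P` are meaningless.
    record Partial (P : Fin n → Bool) (f : Fin n → Fin N) : Set where
      field
        inside : ∀ {x} → P x ≡ true → A (f x) ≡ true
        inj    : ∀ {x y} → P x ≡ true → P y ≡ true → f x ≡ f y → x ≡ y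
        hom    : ∀ {x y} → P x ≡ true → P y ≡ true → Adj x y → R (f x) (f y) ≡ true

    insert : Fin n → (Fin n → Bool) → Fin n → Bool
    insert x P y = does (x ≟ y) ∨ P y

    update : Fin n → Fin N → (Fin n → Fin N) → Fin n → Fin N
    update x z f y = if does (x ≟ y) then z else f y

    insert-⊇ : ∀ x P y → P y ≡ true → insert x P y ≡ true
    insert-⊇ x P y Py = trans (cong (does (x ≟ y) ∨_) Py) (∨-zeroʳ _)

    insert-∋ : ∀ x P → insert x P x ≡ true
    insert-∋ x P = cong (_∨ P x) (dec-true (x ≟ x) refl)

    update-all : ∀ (Q : Fin N → Set) x {z P f} → Q z → (∀ {y} → P y ≡ true → Q (f y)) →
                 ∀ y → insert x P y ≡ true → Q (update x z f y)
    update-all Q x Qz Qf y Py with x ≟ y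
    ... | yes _ = Qz
    ... | no  _ = Qf Py

    place : ∀ {P f} → Partial P f → ∀ x z → A z ≡ true →
            (∀ y → P y ≡ true → z ≢ f y × (Adj x y → R z (f y) ≡ true)) →
            Partial (insert x P) (update x z f)
    place {P} {f} partial x z Az compat = record { inside = inside′ ; inj = inj′ ; hom = hom′ }
      where
      open Partial partial
      inside′ : ∀ {y} → insert x P y ≡ true → A (update x z f y) ≡ true
      inside′ {y} = update-all (λ v → A v ≡ true) x Az (λ {u} → inside {u}) y
      inj′ : ∀ {y y′} → insert x P y ≡ true → insert x P y′ ≡ true →
             update x z f y ≡ update x z f y′ → y ≡ y′
      inj′ {y} {y′} Py Py′ eq with x ≟ y | x ≟ y′
      ... | yes refl | yes refl = refl
      ... | yes refl | no  _    = ⊥-elim (proj₁ (compat y′ Py′) eq)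
      ... | no  _    | yes refl = ⊥-elim (proj₁ (compat y Py) (sym eq))
      ... | no  _    | no  _    = inj Py Py′ eq
      hom′ : ∀ {y y′} → insert x P y ≡ true → insert x P y′ ≡ true → Adj y y′ →
             R (update x z f y) (update x z f y′) ≡ true
      hom′ {y} {y′} Py Py′ a with x ≟ y | x ≟ y′
      ... | yes refl | yes refl = ⊥-elim (irrefl refl a)
      ... | yes refl | no  _    = proj₂ (compat y′ Py′) a
      ... | no  _    | yes refl = R-sym (proj₂ (compat y Py) (adj-sym a))
      ... | no  _    | no  _    = hom Py Py′ a

    Placed : (Fin n → Bool) → (Fin n → Set) → Set
    Placed P Q = Σ[ P′ ∈ (Fin n → Bool) ] Σ[ f ∈ (Fin n → Fin N) ] Partial P′ f ×
                 (∀ {y} → P y ≡ true → P′ y ≡ true) × (∀ {y} → Q y → P′ y ≡ true)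

    place-on-clique : ∀ (high : Fin n → Bool) xs W {P f} → Partial P f →
      (∀ {y} → P y ≡ true → All (λ w → R w (f y) ≡ true) W) →
      A ⊢ W → Clique W → count high xs ≤ length W →
      Placed P (λ y → y ∈ₗ xs × high y ≡ true)
    place-on-clique high [] W {P} {f} partial _ _ _ _ = P , f , partial , (λ Py → Py) , λ ()
    place-on-clique high (x ∷ xs) W {P} {f} partial joined AW cl len
      with high x in hx | subst (_≤ length W) (count-∷ high x xs) len
    ... | false | le with P′ , f′ , partial′ , ⊇ , all ← place-on-clique high xs W partial joined AW cl le =
      P′ , f′ , partial′ , ⊇ , λ where
        (here refl , h) → ⊥-elim (not-¬ h hx)
        (there y∈ , h)  → all (y∈ , h)
    ... | true  | le with P x in px
    -- `xs` may repeat vertices; one that is placed already consumes nothing from `W`.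
    ...   | true with P′ , f′ , partial′ , ⊇ , all ← place-on-clique high xs W partial joined AW cl (<⇒≤ le) =
      P′ , f′ , partial′ , ⊇ , λ where
        (here refl , h) → ⊇ px
        (there y∈ , h)  → all (y∈ , h)
    place-on-clique high (x ∷ xs) (w ∷ W) {P} {f} partial joined (Aw ∷ AW) (Rw ∷ cl) len | true | s≤s le | false
      with P′ , f′ , partial′ , ⊇ , all ← place-on-clique high xs W
             (place partial x w Aw λ y Py → R-irrefl (All.head (joined Py)) , λ _ → All.head (joined Py))
             (λ {y} → update-all (λ v → All (λ u → R u v ≡ true) W) x (All.map R-sym Rw) (λ {y} Py → All.tail (joined {y} Py)) y) AW cl le =
      P′ , f′ , partial′ , (λ {y} Py → ⊇ (insert-⊇ x P y Py)) , λ where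
        (here refl , h) → ⊇ (insert-∋ x P)
        (there y∈ , h)  → all (y∈ , h)

    -- Each of the at most `D` neighbours of the next vertex rules out at most `Δ` vertices, and
    -- each of the `n` values of `f` rules out itself, so some vertex of `A` remains.
    place-greedily : ∀ {Δ D} → (∀ w → # (λ z → not (R z w)) ≤ Δ) → D * Δ + n < # A →
      ∀ xs {P f} → Partial P f → (∀ x → P x ≡ false → degree H x ≤ D) →
      Placed P (_∈ₗ xs)
    place-greedily _ _ [] {P} {f} partial _ = P , f , partial , (λ Py → Py) , λ ()
    place-greedily {Δ} {D} sparse room (x ∷ xs) {P} {f} partial low with P x in px
    ... | true with P′ , f′ , partial′ , ⊇ , all ← place-greedily sparse room xs partial low =
      P′ , f′ , partial′ , ⊇ , λ where
        (here refl) → ⊇ px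
        (there y∈)  → all y∈
    ... | false = continue (sum<#⇒∃0 {P = A} {F = blocked} (≤-<-trans sum-blocked room))
      where
      open ≤-Reasoning
      adj : Fin n → Bool
      adj y = does (adj? x y)
      -- Vertices outside `P` are counted as well, although their images are meaningless; the bound
      -- `D * Δ + n` allows for this.
      obstacle : Fin N → Fin n → ℕ
      obstacle z y = ⟦ adj y ⟧ * ⟦ not (R z (f y)) ⟧ + ⟦ does (f y ≟ z) ⟧
      blocked : Fin N → ℕ
      blocked z = sum (obstacle z)
      per-vertex : ∀ y → sum (λ z → obstacle z y) ≤ ⟦ adj y ⟧ * Δ + 1
      per-vertex y = begin
        sum (λ z → obstacle z y)                                                  ≡⟨ sum-+ (λ z → ⟦ adj y ⟧ * ⟦ not (R z (f y)) ⟧) _ ⟩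
        sum (λ z → ⟦ adj y ⟧ * ⟦ not (R z (f y)) ⟧) + sum (λ z → ⟦ does (f y ≟ z) ⟧) ≡⟨ cong₂ _+_ (trans (sum-cong (λ z → *-comm ⟦ adj y ⟧ _)) (sum-*ʳ (λ z → ⟦ not (R z (f y)) ⟧) ⟦ adj y ⟧)) (sym (#-unfold _)) ⟩
        sum (λ z → ⟦ not (R z (f y)) ⟧) * ⟦ adj y ⟧ + # (λ z → does (f y ≟ z))   ≤⟨ +-mono-≤ (*-monoˡ-≤ ⟦ adj y ⟧ (≤-trans (≤-reflexive (sym (#-unfold _))) (sparse (f y)))) (#-singleton (f y)) ⟩
        Δ * ⟦ adj y ⟧ + 1                                                         ≡⟨ cong (_+ 1) (*-comm Δ _) ⟩
        ⟦ adj y ⟧ * Δ + 1                                                         ∎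
      sum-blocked : sum blocked ≤ D * Δ + n
      sum-blocked = begin
        sum blocked                               ≡⟨ sum-swap obstacle ⟩
        sum (λ y → sum (λ z → obstacle z y))      ≤⟨ sum-mono per-vertex ⟩
        sum (λ y → ⟦ adj y ⟧ * Δ + 1)             ≡⟨ sum-+ (λ y → ⟦ adj y ⟧ * Δ) _ ⟩
        sum (λ y → ⟦ adj y ⟧ * Δ) + sum {n} (λ _ → 1) ≡⟨ cong₂ _+_ (sum-*ʳ (λ y → ⟦ adj y ⟧) Δ) (trans (sum-const n 1) (*-identityʳ n)) ⟩
        sum (λ y → ⟦ adj y ⟧) * Δ + n             ≡⟨ cong (λ d → d * Δ + n) (#-unfold adj) ⟨
        degree H x * Δ + n                        ≤⟨ +-monoˡ-≤ n (*-monoˡ-≤ Δ (low x px)) ⟩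
        D * Δ + n                                 ∎
      compat : ∀ z → blocked z ≡ 0 → ∀ y → P y ≡ true → z ≢ f y × (Adj x y → R z (f y) ≡ true)
      compat z free y Py =
        does-false⇒ (f y ≟ z) (⟦⟧≡0 (m+n≡0⇒n≡0 (⟦ adj y ⟧ * ⟦ not (R z (f y)) ⟧) clear)) ∘ sym ,
        λ a → hit (trans (cong (λ b → ⟦ b ⟧ * ⟦ not (R z (f y)) ⟧) (sym (dec-true (adj? x y) a)))
                         (m+n≡0⇒m≡0 _ clear))
        where
        clear : obstacle z y ≡ 0
        clear = n≤0⇒n≡0 (≤-trans (≤-sum (obstacle z) y) (≤-reflexive free))
        hit : ∀ {b} → 1 * ⟦ not b ⟧ ≡ 0 → b ≡ true
        hit {true} _ = refl
      low₁ : ∀ y → insert x P y ≡ false → degree H y ≤ D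
      low₁ y eq with x ≟ y
      ... | no _ = low y eq
      continue : ∃[ z ] A z ≡ true × blocked z ≡ 0 → Placed P (_∈ₗ (x ∷ xs))
      continue (z , Az , free)
        with P′ , f′ , partial′ , ⊇ , all ← place-greedily sparse room xs (place partial x z Az (compat z free)) low₁ =
        P′ , f′ , partial′ , (λ {y} Py → ⊇ (insert-⊇ x P y Py)) , λ where
          (here refl) → ⊇ (insert-∋ x P)
          (there y∈)  → all y∈

    high : ℕ → Fin n → Bool
    high D x = does (D ≤? degree H x)

    embed : ∀ {Δ D} → (∀ w → # (λ z → not (R z w)) ≤ Δ) → D * Δ + n < # A →
            ∀ W → A ⊢ W → Clique W → # (high D) ≤ length W →
            Fin N →
            Σ[ f ∈ (Fin n → Fin N) ] Injective _≡_ _≡_ f × (∀ x → A (f x) ≡ true) ×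
              (∀ x y → Adj x y → R (f x) (f y) ≡ true)
    embed {Δ} {D} sparse room W AW cl len z
      with P₁ , f₁ , partial₁ , _ , all₁ ←
             -- The domain is empty at the start, and `z` is an arbitrary default value.
             place-on-clique (high D) (allFin n) W {λ _ → false} {λ _ → z}
               (record { inside = λ () ; inj = λ () ; hom = λ () }) (λ ()) AW cl
               (≤-trans (≤-reflexive (count-tabulate (high D) (λ x → x))) len)
      with P₂ , f₂ , partial₂ , _ , all₂ ←
             place-greedily sparse room (allFin n) partial₁
               (λ x ¬P → ≰⇒≥ λ D≤ → not-¬ (all₁ (∈-allFin x , dec-true (D ≤? degree H x) D≤)) ¬P)
      = f₂ , inj (all₂ (∈-allFin _)) (all₂ (∈-allFin _)) ,
        (λ x → inside (all₂ (∈-allFin x))) ,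
        λ x y → hom (all₂ (∈-allFin x)) (all₂ (∈-allFin y))
      where open Partial partial₂

-- Colourings without a monochromatic copy of G

-- A finite search over the codes of maps. Decidability makes the final argument by contradiction
-- constructive.
copy? : ∀ {n N} (F : Graph n) (χ : TwoColoring N) → Dec (MonochromaticCopy F χ)
copy? {n} {N} F χ = map′ (λ (j , c) → finToFun j , c) code (any? λ j → isCopy? (finToFun j))
  where
  open Graph F using (Adj; adj?)
  open TwoColoring χ
  IsCopy : (Fin n → Fin N) → Set
  IsCopy f = Injective _≡_ _≡_ f × (∃[ c ] ∀ x y → Adj x y → colour (f x) (f y) ≡ c)
  mono? : ∀ f c → Dec (∀ x y → Adj x y → colour (f x) (f y) ≡ c)
  mono? f c = all? λ x → all? λ y → adj? x y →-dec (colour (f x) (f y) Bool.≟ c)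
  colour? : ∀ {P : Bool → Set} → (∀ c → Dec (P c)) → Dec (∃[ c ] P c)
  colour? P? with P? true | P? false
  ... | yes p | _     = yes (true , p)
  ... | no _  | yes p = yes (false , p)
  ... | no ¬p | no ¬q = no λ { (true , p) → ¬p p ; (false , q) → ¬q q }
  isCopy? : ∀ f → Dec (IsCopy f)
  isCopy? f = map′ (λ inj {x} {y} → inj x y) (λ inj x y → inj {x} {y})
                (all? λ x → all? λ y → (f x ≟ f y) →-dec (x ≟ y))
              ×-dec colour? (mono? f)
  code : MonochromaticCopy F χ → ∃[ j ] IsCopy (finToFun j)
  code (f , inj , c , mono) = funToFin f ,
    (λ {x} {y} eq → inj (trans (sym (f′≗f x)) (trans eq (f′≗f y)))) ,
    c , λ x y a → trans (cong₂ colour (f′≗f x) (f′≗f y)) (mono x y a)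
    where
    f′≗f : ∀ x → finToFun (funToFin f) x ≡ f x
    f′≗f = finToFun-funToFin f

lookup-AllPairs : ∀ {A : Set} {S : A → A → Set} → Symmetric S → ∀ {xs} → AllPairs S xs →
                  ∀ i j → i ≢ j → S (lookup xs i) (lookup xs j)
lookup-AllPairs S-sym (a ∷ ap) zero    zero    i≢j = ⊥-elim (i≢j refl)
lookup-AllPairs S-sym (a ∷ ap) zero    (suc j) i≢j = All.lookup a (∈-lookup j)
lookup-AllPairs S-sym (a ∷ ap) (suc i) zero    i≢j = S-sym (All.lookup a (∈-lookup i))
lookup-AllPairs S-sym (a ∷ ap) (suc i) (suc j) i≢j = lookup-AllPairs S-sym ap i j (i≢j ∘ cong suc)

-- Case distinction on a vertex of `G`: the deleted vertex, or a vertex of `H`.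
data PunchView {n} (v : Fin (suc n)) : Fin (suc n) → Set where
  at    : PunchView v v
  other : ∀ y → PunchView v (punchIn v y)

punchView : ∀ {n} (v x : Fin (suc n)) → PunchView v x
punchView v x with v ≟ x
... | yes refl = at
... | no  v≢x  = subst (PunchView v) (punchIn-punchOut v≢x) (other (punchOut v≢x))

module Colouring {N} (χ : TwoColoring N) where
  open TwoColoring χ

  -- The colour on the diagonal is arbitrary, so no vertex is a neighbour of itself in either
  -- colour.
  nb : Bool → Fin N → Fin N → Bool
  nb c x y = not (does (x ≟ y)) ∧ does (colour x y Bool.≟ c)

  nb⇒≢ : ∀ {c x y} → nb c x y ≡ true → x ≢ y
  nb⇒≢ {c} {x} {y} eq = does-false⇒ (x ≟ y) (not-true (proj₁ (∧-true eq)))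

  nb⇒colour : ∀ {c x y} → nb c x y ≡ true → colour x y ≡ c
  nb⇒colour {c} {x} {y} eq = does-true⇒ (colour x y Bool.≟ c) (proj₂ (∧-true {not (does (x ≟ y))} eq))

  ≢⇒nb : ∀ {c x y} → x ≢ y → colour x y ≡ c → nb c x y ≡ true
  ≢⇒nb {c} {x} {y} x≢y eq =
    cong₂ _∧_ (cong not (dec-false (x ≟ y) x≢y)) (dec-true (colour x y Bool.≟ c) eq)

  nb-sym : ∀ {c x y} → nb c x y ≡ true → nb c y x ≡ true
  nb-sym {c} {x} {y} eq = ≢⇒nb (nb⇒≢ {c} eq ∘ sym) (trans (colour-sym y x) (nb⇒colour eq))

  nb-swap : ∀ c x y → nb c x y ≡ nb c y x
  nb-swap c x y with nb c x y in p | nb c y x in q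
  ... | true  | true  = refl
  ... | false | false = refl
  ... | true  | false = trans (sym (nb-sym {c} {x} {y} p)) q
  ... | false | true  = trans (sym p) (nb-sym {c} {y} {x} q)

  ¬nb⇒colour : ∀ {c x y} → x ≢ y → nb c x y ≡ false → colour x y ≡ not c
  ¬nb⇒colour {c} x≢y ¬nb = ¬-not λ eq → not-¬ (≢⇒nb x≢y eq) ¬nb

  ¬nb⇒nb : ∀ {c x y} → x ≢ y → nb c x y ≡ false → nb (not c) x y ≡ true
  ¬nb⇒nb x≢y ¬nb = ≢⇒nb x≢y (¬nb⇒colour x≢y ¬nb)

  module _ {n} (G : Graph (suc n)) (v : Fin (suc n)) where
    open Graph G renaming (sym to adj-sym)

    extend-copy : ∀ {c w} (f : Fin n → Fin N) → Injective _≡_ _≡_ f →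
      (∀ x y → Adj (punchIn v x) (punchIn v y) → colour (f x) (f y) ≡ c) →
      (∀ x → nb c w (f x) ≡ true) → MonochromaticCopy G χ
    extend-copy {c} {w} f inj mono joined = F , F-inj , c , F-mono
      where
      F : Fin (suc n) → Fin N
      F = insertAt f v w
      Fv : F v ≡ w
      Fv = insertAt-lookup f v w
      Fp : ∀ y → F (punchIn v y) ≡ f y
      Fp = insertAt-punchIn f v w
      F-inj : Injective _≡_ _≡_ F
      F-inj {x} {y} eq with punchView v x | punchView v y
      ... | at      | at      = refl
      ... | at      | other b = ⊥-elim (nb⇒≢ {c} (joined b) (trans (sym Fv) (trans eq (Fp b))))
      ... | other a | at      = ⊥-elim (nb⇒≢ {c} (joined a) (trans (sym Fv) (trans (sym eq) (Fp a))))
      ... | other a | other b = cong (punchIn v) (inj (trans (sym (Fp a)) (trans eq (Fp b))))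
      F-mono : ∀ x y → Adj x y → colour (F x) (F y) ≡ c
      F-mono x y a with punchView v x | punchView v y
      ... | at      | at      = ⊥-elim (irrefl refl a)
      ... | at      | other q = trans (cong₂ colour Fv (Fp q)) (nb⇒colour (joined q))
      ... | other p | at      = trans (colour-sym _ _) (trans (cong₂ colour Fv (Fp p)) (nb⇒colour (joined p)))
      ... | other p | other q = trans (cong₂ colour (Fp p) (Fp q)) (mono p q a)

    -- The pairs all have colour `c`, and a clique on `n + 1` vertices contains every graph of that
    -- order.
    clique-copy : ∀ {c xs} → AllPairs (λ x y → x ≢ y × nb (not c) x y ≡ false) xs →
                  length xs ≡ suc n → MonochromaticCopy G χ
    clique-copy {c} {xs} ap len = go len (lookup xs)
      (lookup-AllPairs (λ {x} {y} (x≢y , eq) → x≢y ∘ sym , trans (nb-swap (not c) y x) eq) ap)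
      where
      go : ∀ {m} → m ≡ suc n → (g : Fin m → Fin N) →
           (∀ i j → i ≢ j → g i ≢ g j × nb (not c) (g i) (g j) ≡ false) → MonochromaticCopy G χ
      go refl g pair = g , inj , c ,
        λ x y a → let g≢ , ¬nb = pair x y (λ { refl → irrefl refl a })
                  in trans (¬nb⇒colour g≢ ¬nb) (not-involutive c)
        where
        inj : Injective _≡_ _≡_ g
        inj {i} {j} eq with i ≟ j
        ... | yes i≡j = i≡j
        ... | no  i≢j = ⊥-elim (proj₁ (pair i j i≢j) eq)

    copy-in : ∀ {r} → Arrows r (deleteVertex G v) → ∀ (U : Fin N → Bool) → r ≤ # U →
      Σ[ f ∈ (Fin n → Fin N) ] Injective _≡_ _≡_ f × (∀ x → U (f x) ≡ true) ×
        ∃[ c ] ∀ x y → Adj (punchIn v x) (punchIn v y) → colour (f x) (f y) ≡ c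
    copy-in arrows U big
      with g , g-inj , Ug ← enumerate U big
      with f , f-inj , c , mono ← arrows (record { colour = λ x y → colour (g x) (g y) ; colour-sym = λ x y → colour-sym (g x) (g y) })
      = g ∘ f , f-inj ∘ g-inj , Ug ∘ f , c , mono

    module CopyFree {r} (arrows : Arrows r (deleteVertex G v)) (¬copy : ¬ MonochromaticCopy G χ) where

      -- A copy of H inside this set would extend to a copy of G by u or by w.
      crossing : ∀ c u w → # (λ x → nb c u x ∧ nb (not c) w x) < r
      crossing c u w = ≰⇒> λ big → ¬copy (go (copy-in arrows _ big))
        where
        go : _ → MonochromaticCopy G χ
        go (f , inj , U , c′ , mono) with c′ Bool.≟ c
        ... | yes refl = extend-copy f inj mono (λ x → proj₁ (∧-true {nb c′ u (f x)} (U x)))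
        ... | no  c′≢c = extend-copy f inj mono
          (λ x → subst (λ d → nb d w (f x) ≡ true) (sym (¬-not c′≢c)) (proj₂ (∧-true {nb c u (f x)} (U x))))

      -- Double count the pairs between the two neighbourhoods of `u`. By `crossing`, each `x` on
      -- the true side has fewer than `r` true neighbours across, and each `y` on the false side
      -- fewer than `r` false ones.
      product-≤ : ∀ u → # (nb true u) * # (nb false u) ≤ # (nb true u) * r + # (nb false u) * r
      product-≤ u = begin
        # A * # B                                                      ≡⟨ cong (_* # B) (#-unfold A) ⟩
        sum (λ x → ⟦ A x ⟧) * # B                                      ≡⟨ sum-*ʳ (λ x → ⟦ A x ⟧) (# B) ⟨
        sum (λ x → ⟦ A x ⟧ * # B)                                      ≤⟨ sum-mono (λ x → ind (A x) (B≤ x)) ⟩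
        sum (λ x → ⟦ A x ⟧ * r + ⟦ A x ⟧ * # (λ y → B y ∧ nb false x y)) ≡⟨ sum-+ (λ x → ⟦ A x ⟧ * r) _ ⟩
        sum (λ x → ⟦ A x ⟧ * r) + sum (λ x → ⟦ A x ⟧ * # (λ y → B y ∧ nb false x y)) ≡⟨ cong₂ _+_ (trans (sum-*ʳ (λ x → ⟦ A x ⟧) r) (cong (_* r) (sym (#-unfold A)))) swap ⟩
        # A * r + sum (λ y → ⟦ B y ⟧ * # (λ x → A x ∧ nb false y x))   ≤⟨ +-monoʳ-≤ (# A * r) (sum-weighted-≤ B (λ y _ → <⇒≤ (crossing true u y))) ⟩
        # A * r + # B * r                                              ∎
        where
        open ≤-Reasoning
        A B : Fin N → Bool
        A = nb true u
        B = nb false u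
        ind : ∀ b {k l m} → (b ≡ true → k ≤ l + m) → ⟦ b ⟧ * k ≤ ⟦ b ⟧ * l + ⟦ b ⟧ * m
        ind false _ = z≤n
        ind true {k} {l} {m} le = subst₂ _≤_ (sym (+-identityʳ k)) (sym (cong₂ _+_ (+-identityʳ l) (+-identityʳ m))) (le refl)
        B≤ : ∀ x → A x ≡ true → # B ≤ r + # (λ y → B y ∧ nb false x y)
        B≤ x Ax = ≤-trans (#-cover (λ y → nb true x y ∧ B y) _ cover) (+-monoˡ-≤ _ (<⇒≤ (crossing true x u)))
          where
          cover : ∀ y → B y ≡ true → nb true x y ∧ B y ≡ false → B y ∧ nb false x y ≡ true
          cover y By ¬xy = cong₂ _∧_ By (¬nb⇒nb x≢y ¬nb)
            where
            x≢y : x ≢ y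
            x≢y refl = not-¬ (trans (sym (nb⇒colour {true} Ax)) (nb⇒colour {false} By)) refl
            ¬nb : nb true x y ≡ false
            ¬nb = trans (sym (Bool.∧-identityʳ _)) (trans (cong (nb true x y ∧_) (sym By)) ¬xy)
        pointwise : ∀ a b {f g} → f ≡ g → ⟦ b ∧ f ⟧ * ⟦ a ⟧ ≡ ⟦ a ∧ g ⟧ * ⟦ b ⟧
        pointwise true  true  refl = refl
        pointwise false false refl = refl
        pointwise false true {f} refl = *-zeroʳ ⟦ f ⟧
        pointwise true  false {f} refl = sym (*-zeroʳ ⟦ f ⟧)
        expand : ∀ (P : Fin N → Bool) b → ⟦ b ⟧ * # P ≡ sum (λ y → ⟦ P y ⟧ * ⟦ b ⟧)
        expand P b = trans (*-comm ⟦ b ⟧ _) (trans (cong (_* ⟦ b ⟧) (#-unfold P)) (sym (sum-*ʳ (λ y → ⟦ P y ⟧) ⟦ b ⟧)))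
        swap : sum (λ x → ⟦ A x ⟧ * # (λ y → B y ∧ nb false x y)) ≡ sum (λ y → ⟦ B y ⟧ * # (λ x → A x ∧ nb false y x))
        swap = begin-equality
          sum (λ x → ⟦ A x ⟧ * # (λ y → B y ∧ nb false x y))           ≡⟨ sum-cong (λ x → expand (λ y → B y ∧ nb false x y) (A x)) ⟩
          sum (λ x → sum (λ y → ⟦ B y ∧ nb false x y ⟧ * ⟦ A x ⟧))     ≡⟨ sum-swap (λ x y → ⟦ B y ∧ nb false x y ⟧ * ⟦ A x ⟧) ⟩
          sum (λ y → sum (λ x → ⟦ B y ∧ nb false x y ⟧ * ⟦ A x ⟧))     ≡⟨ sum-cong (λ y → sum-cong (λ x → pointwise (A x) (B y) (nb-swap false x y))) ⟩
          sum (λ y → sum (λ x → ⟦ A x ∧ nb false y x ⟧ * ⟦ B y ⟧))     ≡⟨ sum-cong (λ y → expand (λ x → A x ∧ nb false y x) (B y)) ⟨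
          sum (λ y → ⟦ B y ⟧ * # (λ x → A x ∧ nb false y x))           ∎

      -- The right-hand side is at most `2 * a * r`, and a positive `a` cancels.
      small-factor : ∀ a b → a * b ≤ a * r + b * r → b ≤ a → b ≤ 2 * r
      small-factor zero    b _  b≤a = ≤-trans b≤a z≤n
      small-factor (suc a) b le b≤a = *-cancelˡ-≤ (suc a) (begin
        suc a * b                ≤⟨ le ⟩
        suc a * r + b * r        ≤⟨ +-monoʳ-≤ (suc a * r) (*-monoˡ-≤ r b≤a) ⟩
        suc a * r + suc a * r    ≡⟨ *-distribˡ-+ (suc a) r r ⟨
        suc a * (r + r)          ≡⟨ cong (λ k → suc a * (r + k)) (+-identityʳ r) ⟨
        suc a * (2 * r)          ∎)
        where open ≤-Reasoning

      minority : ∀ u → ∃[ c ] # (nb (not c) u) ≤ 2 * r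
      minority u with ≤-total (# (nb false u)) (# (nb true u))
      ... | inj₁ le = true , small-factor _ _ (product-≤ u) le
      ... | inj₂ le = false , small-factor (# (nb false u)) _
        (≤-trans (≤-reflexive (*-comm (# (nb false u)) _)) (≤-trans (product-≤ u) (≤-reflexive (+-comm (# (nb true u) * r) _)))) le

      module _ {u c} (small : # (nb (not c) u) ≤ 2 * r) where

        -- The 1 accounts for `u` itself, which `nb` excludes.
        complement-≤ : # (λ x → not (nb c u x)) ≤ 1 + 2 * r
        complement-≤ = ≤-trans (#-cover (λ x → does (u ≟ x)) (nb (not c) u) cover) (+-mono-≤ (#-singleton u) small)
          where
          cover : ∀ x → not (nb c u x) ≡ true → does (u ≟ x) ≡ false → nb (not c) u x ≡ true
          cover x ¬nb u≢x = ¬nb⇒nb (does-false⇒ (u ≟ x) u≢x) (not-true ¬nb)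

        majority-≥ : N ≤ # (nb c u) + (1 + 2 * r)
        majority-≥ = begin
          N                                       ≡⟨ #-true N ⟨
          # {N} (λ _ → true)                      ≤⟨ #-cover (nb c u) (λ x → not (nb c u x)) (λ x _ eq → cong not eq) ⟩
          # (nb c u) + # (λ x → not (nb c u x))   ≤⟨ +-monoʳ-≤ (# (nb c u)) complement-≤ ⟩
          # (nb c u) + (1 + 2 * r)                ∎
          where open ≤-Reasoning

        -- A single vertex `u` of small bad degree controls all others: the bad neighbours of `w`
        -- are either good neighbours of `u`, fewer than `r` by `crossing`, or lie in the small
        -- complement.
        minority-degree : ∀ w → # (λ z → not (nb c z w)) ≤ 1 + 3 * r
        minority-degree w = begin
          # (λ z → not (nb c z w))               ≤⟨ #-cover (λ z → does (w ≟ z)) (nb (not c) w) cover₁ ⟩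
          # (λ z → does (w ≟ z)) + # (nb (not c) w) ≤⟨ +-mono-≤ (#-singleton w) (#-cover (λ z → nb c u z ∧ nb (not c) w z) _ cover₂) ⟩
          1 + (# (λ z → nb c u z ∧ nb (not c) w z) + # (λ z → not (nb c u z))) ≤⟨ s≤s (+-monoʳ-≤ _ complement-≤) ⟩
          1 + (# (λ z → nb c u z ∧ nb (not c) w z) + suc (2 * r)) ≡⟨ cong suc (+-suc _ (2 * r)) ⟩
          -- Strictness in `crossing` absorbs the 1 that came from `complement-≤`.
          1 + (suc (# (λ z → nb c u z ∧ nb (not c) w z)) + 2 * r) ≤⟨ s≤s (+-monoˡ-≤ (2 * r) (crossing c u w)) ⟩
          1 + 3 * r                              ∎
          where
          open ≤-Reasoning
          cover₁ : ∀ z → not (nb c z w) ≡ true → does (w ≟ z) ≡ false → nb (not c) w z ≡ true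
          cover₁ z ¬nb w≢z = ¬nb⇒nb (does-false⇒ (w ≟ z) w≢z) (trans (nb-swap c w z) (not-true ¬nb))
          cover₂ : ∀ z → nb (not c) w z ≡ true → nb c u z ∧ nb (not c) w z ≡ false → not (nb c u z) ≡ true
          cover₂ z wz ¬uw with nb c u z
          ... | false = refl
          ... | true  = trans (sym ¬uw) wz

-- The choice of parameters

-- Rounds down an inverse of `f`; it supplies both the integer logarithm and the integer square
-- root.
bracket : ∀ (f : ℕ → ℕ) → (∀ k → f k < f (suc k)) → ∀ n → f 0 ≤ n →
          ∃[ k ] f k ≤ n × n < f (suc k)
bracket f f< zero    f0≤ = 0 , f0≤ , ≤-<-trans z≤n (f< 0)
bracket f f< (suc n) f0≤ with f 0 ≤? n
... | no  f0≰ = 0 , f0≤ , ≤-<-trans (≰⇒> f0≰) (f< 0)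
... | yes f0≤n with k , fk≤ , n< ← bracket f f< n f0≤n | suc n <? f (suc k)
...   | yes lt  = k , m≤n⇒m≤1+n fk≤ , lt
...   | no  ¬lt = suc k , ≮⇒≥ ¬lt , ≤-<-trans n< (f< (suc k))

index-positive : ∀ (f : ℕ → ℕ) {k n} → n < f (suc k) → f 1 ≤ n → 1 ≤ k
index-positive f {zero}  n< f1≤ = ⊥-elim (<⇒≱ n< f1≤)
index-positive f {suc k} _  _   = s≤s z≤n

^-cancelˡ-≤ : ∀ n {a b} → 1 ≤ n → a ^ n ≤ b ^ n → a ≤ b
^-cancelˡ-≤ (suc n) _ le = ≮⇒≥ λ b<a → <⇒≱ (^-monoˡ-< (suc n) b<a) le

-- Compare `n`-th powers. With `suc L ≤ 2 * L` and `suc K ≤ 2 * K`, twice the exponent of 2 needed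
-- on the left is at most `2 + 32 * (q * (K * K))`, whereas `2 * e` is at least `4 * (s * K)` and
-- `s` is at least `24 * (q * K)`.
power-≤ : ∀ {n L K q s e r} → 1 ≤ n → 1 ≤ L → 1 ≤ K → 1 ≤ r →
          suc n ≤ 2 ^ suc L → n * L ≤ suc K * suc K → q * (24 * K) ≤ s →
          s * (4 * K) ≤ 2 * e → 2 ^ e ≤ 2 * r ^ n → suc n ^ q * suc n ^ q ≤ r
power-≤ {q = zero} _ _ _ 1≤r _ _ _ _ _ = 1≤r
power-≤ {n} {L} {K} {q@(suc q-1)} {s} {e} {r} 1≤n 1≤L 1≤K 1≤r n<2^L nL≤ q≤ s≤ 2^e≤ =
  ^-cancelˡ-≤ n 1≤n (*-cancelˡ-≤ 2 (begin
    2 * (suc n ^ q * suc n ^ q) ^ n        ≡⟨ cong (λ k → 2 * k ^ n) (^-distribˡ-+-* (suc n) q q) ⟨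
    2 * (suc n ^ (q + q)) ^ n              ≡⟨ cong (2 *_) (^-*-assoc (suc n) (q + q) n) ⟩
    2 * suc n ^ ((q + q) * n)              ≤⟨ *-monoʳ-≤ 2 (^-monoˡ-≤ ((q + q) * n) n<2^L) ⟩
    2 * (2 ^ suc L) ^ ((q + q) * n)        ≡⟨ cong (2 *_) (^-*-assoc 2 (suc L) ((q + q) * n)) ⟩
    2 ^ suc (suc L * ((q + q) * n))        ≤⟨ ^-monoʳ-≤ 2 exponent ⟩
    2 ^ e                                  ≤⟨ 2^e≤ ⟩
    2 * r ^ n                              ∎))
  where
  open ≤-Reasoning
  -- This needs `q` positive; it pays for the factor 2 in front of the powers.
  1≤sK : 1 ≤ s * K
  1≤sK = *-mono-≤ (≤-trans (*-mono-≤ {1} {q} (s≤s z≤n) (*-mono-≤ {1} {24} (s≤s z≤n) 1≤K)) q≤) 1≤K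
  exponent : suc (suc L * ((q + q) * n)) ≤ e
  exponent = *-cancelˡ-≤ 2 (begin
    2 * suc (suc L * ((q + q) * n))             ≤⟨ *-monoʳ-≤ 2 (s≤s (*-monoˡ-≤ ((q + q) * n) (+-monoˡ-≤ L 1≤L))) ⟩
    2 * suc ((L + L) * ((q + q) * n))           ≡⟨ eq₁ L q n ⟩
    2 + 8 * q * (n * L)                         ≤⟨ +-monoʳ-≤ 2 (*-monoʳ-≤ (8 * q) nL≤) ⟩
    2 + 8 * q * (suc K * suc K)                 ≤⟨ +-monoʳ-≤ 2 (*-monoʳ-≤ (8 * q) (*-mono-≤ (+-monoˡ-≤ K 1≤K) (+-monoˡ-≤ K 1≤K))) ⟩
    2 + 8 * q * ((K + K) * (K + K))             ≡⟨ eq₂ 8 q K ⟩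
    -- 32 is raised to 48 = 2 * 24 to match the divisor `24 * K`.
    2 + 32 * (q * (K * K))                      ≤⟨ +-mono-≤ (*-monoʳ-≤ 2 1≤sK) (*-monoˡ-≤ (q * (K * K)) (m≤m+n 32 16)) ⟩
    2 * (s * K) + 48 * (q * (K * K))            ≡⟨ eq₃ 24 s q K ⟩
    2 * (s * K) + 2 * (q * (24 * K) * K)        ≤⟨ +-monoʳ-≤ (2 * (s * K)) (*-monoʳ-≤ 2 (*-monoˡ-≤ K q≤)) ⟩
    2 * (s * K) + 2 * (s * K)                   ≡⟨ eq₄ s K ⟩
    s * (4 * K)                                 ≤⟨ s≤ ⟩
    2 * e                                       ∎)
    where
    eq₁ : ∀ L q n → 2 * suc ((L + L) * ((q + q) * n)) ≡ 2 + 8 * q * (n * L)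
    eq₁ = solve-∀
    eq₂ : ∀ a q K → 2 + a * q * ((K + K) * (K + K)) ≡ 2 + a * 4 * (q * (K * K))
    eq₂ = solve-∀
    eq₃ : ∀ a s q K → 2 * (s * K) + 2 * a * (q * (K * K)) ≡ 2 * (s * K) + 2 * (q * (a * K) * K)
    eq₃ = solve-∀
    eq₄ : ∀ s K → 2 * (s * K) + 2 * (s * K) ≡ s * (4 * K)
    eq₄ = solve-∀

division : ∀ s d → 1 ≤ d → ∃[ q ] q * d ≤ s × s ≤ suc q * d
division s d@(suc _) _ = s / d ,
  ≤-trans (m≤n+m _ (s % d)) (≤-reflexive (sym (m≡m%n+[m/n]*n s d))) ,
  ≤-trans (≤-reflexive (m≡m%n+[m/n]*n s d)) (+-monoˡ-≤ (s / d * d) (<⇒≤ (m%n<n s d)))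

arrows⇒n≤r : ∀ {n r} {F : Graph n} → Arrows r F → n ≤ r
arrows⇒n≤r {n} {r} arrows
  with f , inj , _ ← arrows (record { colour = λ _ _ → true ; colour-sym = λ _ _ → refl }) =
  ≤-trans (injection⇒≤# {P = λ _ → true} inj (λ _ → refl)) (≤-reflexive (#-true r))

-- The contradiction in a large colouring

module VertexDeletion {n : ℕ} (G : Graph (suc n)) (v : Fin (suc n))
         {r : ℕ} (arrows : Arrows r (deleteVertex G v))
         {L K : ℕ} (2≤n : 2 ≤ n) (1≤L : 1 ≤ L) (1≤K : 1 ≤ K)
         (n<2^ : suc n ≤ 2 ^ suc L) (nL≤ : n * L ≤ suc K * suc K) where

  H : Graph n
  H = deleteVertex G v

  1≤n : 1 ≤ n
  1≤n = ≤-trans (s≤s z≤n) 2≤n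

  n≤r : n ≤ r
  n≤r = arrows⇒n≤r {F = H} arrows

  1≤r : 1 ≤ r
  1≤r = ≤-trans 1≤n n≤r

  1≤Kr : 1 ≤ K * r
  1≤Kr = *-mono-≤ 1≤K 1≤r

  r≤Kr : r ≤ K * r
  r≤Kr = ≤-trans (≤-reflexive (sym (*-identityˡ r))) (*-monoˡ-≤ r 1≤K)

  module CopyFreeLarge {N} (χ : TwoColoring N) (N-large : 200 * (r * K) ≤ N)
               (¬copy : ¬ MonochromaticCopy G χ)
               {u c} (small : # (Colouring.nb χ (not c) u) ≤ 2 * r) where

    open ≤-Reasoning

    R : Fin N → Fin N → Bool
    R = Colouring.nb χ c

    A : Fin N → Bool
    A = R u

    R-sym : ∀ {x y} → R x y ≡ true → R y x ≡ true
    R-sym {x} {y} = Colouring.nb-sym χ {c} {x} {y}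

    R-irrefl : ∀ {x y} → R x y ≡ true → x ≢ y
    R-irrefl {x} {y} = Colouring.nb⇒≢ χ {c} {x} {y}

    -- The vertices outside `A` number at most `3 * (K * r)`, so 200 leaves room for the 192 = 2 *
    -- 24 * 4 that `cond₁` requires.
    A-large : 192 * (K * r) ≤ # A
    A-large = +-cancelʳ-≤ (1 + 2 * r) (192 * (K * r)) (# A) (begin
      192 * (K * r) + (1 + 2 * r)           ≤⟨ +-monoʳ-≤ (192 * (K * r)) (+-mono-≤ 1≤Kr (*-monoʳ-≤ 2 {r} {K * r} r≤Kr)) ⟩
      192 * (K * r) + (K * r + 2 * (K * r)) ≤⟨ m≤m+n _ (5 * (K * r)) ⟩
      192 * (K * r) + (K * r + 2 * (K * r)) + 5 * (K * r) ≡⟨ eq 192 5 K r ⟩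
      200 * (r * K)                         ≤⟨ N-large ⟩
      N                                     ≤⟨ Colouring.CopyFree.majority-≥ χ G v arrows ¬copy small ⟩
      # A + (1 + 2 * r)                     ∎)
      where
      eq : ∀ a b K r → a * (K * r) + (K * r + 2 * (K * r)) + b * (K * r) ≡ (a + 3 + b) * (r * K)
      eq = solve-∀

    sparse : ∀ w → # (λ z → not (R z w)) ≤ 4 * r
    sparse w = ≤-trans (Colouring.CopyFree.minority-degree χ G v arrows ¬copy small w) (+-monoˡ-≤ (3 * r) 1≤r)

    no-coclique : ∀ xs → Host.Coclique R R-sym R-irrefl xs → length xs ≢ suc n
    no-coclique xs co len = ¬copy (Colouring.clique-copy χ G v {not c}
      (subst (λ d → AllPairs (λ x y → x ≢ y × Colouring.nb χ d x y ≡ false) xs) (sym (not-involutive c)) co) len)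

    high : Fin n → Bool
    high = Host.Embed.high R R-sym R-irrefl H A (4 * K)

    s≤n : # high ≤ suc n
    s≤n = begin
      # high                    ≤⟨ #-mono {Q = λ _ → true} (λ _ _ → refl) ⟩
      # {n} (λ _ → true)        ≡⟨ #-true n ⟩
      n                         ≤⟨ n≤1+n n ⟩
      suc n                     ∎

    sD≤2e : # high * (4 * K) ≤ 2 * edgeCount H
    sD≤2e = ≤-trans (markov high (λ x → does-true⇒ (4 * K ≤? degree H x))) (sum-degree-≤ H)

    -- The degree threshold times the bad degree, plus `n`, is at most `17 * (K * r)`.
    room : 4 * K * (4 * r) + n < # A
    room = begin-strict
      4 * K * (4 * r) + n                   ≤⟨ +-monoʳ-≤ (4 * K * (4 * r)) (≤-trans n≤r r≤Kr) ⟩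
      4 * K * (4 * r) + K * r               <⟨ m<m+n (4 * K * (4 * r) + K * r) (m≤n⇒m≤o*n {1} {K * r} 175 1≤Kr) ⟩
      4 * K * (4 * r) + K * r + 175 * (K * r) ≡⟨ eq 4 4 175 K r ⟩
      192 * (K * r)                         ≤⟨ A-large ⟩
      # A                                   ∎
      where
      eq : ∀ a b c K r → a * K * (b * r) + K * r + c * (K * r) ≡ (a * b + 1 + c) * (K * r)
      eq = solve-∀

    module _ {q} (q≤ : q * (24 * K) ≤ # high) (≤q : # high ≤ suc q * (24 * K)) where

      -- The averaging condition of `large-clique`; it rests on `q` not being too small.
      cond₁ : 2 * (# high * (4 * r)) ≤ suc q * # A
      cond₁ = begin
        2 * (# high * (4 * r))                ≤⟨ *-monoʳ-≤ 2 (*-monoˡ-≤ (4 * r) ≤q) ⟩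
        2 * (suc q * (24 * K) * (4 * r))      ≡⟨ eq (suc q) 24 4 K r ⟩
        suc q * (192 * (K * r))               ≤⟨ *-monoʳ-≤ (suc q) A-large ⟩
        suc q * # A                           ∎
        where
        eq : ∀ q a b K r → 2 * (q * (a * K) * (b * r)) ≡ q * (2 * (a * b) * (K * r))
        eq = solve-∀

      power : suc n ^ q * suc n ^ q ≤ r
      power = power-≤ {n} {L} {K} {q} {# high} {edgeCount H} {r} 1≤n 1≤L 1≤K 1≤r n<2^ nL≤ q≤ sD≤2e (2^edgeCount≤ H arrows)

      -- The Ramsey condition of `large-clique`; it rests on `q` not being too large, through the
      -- lower bound on `r`.
      cond₂ : 2 * (suc n ^ q * # high ^ q) ≤ # A
      cond₂ = begin
        2 * (suc n ^ q * # high ^ q)          ≤⟨ *-monoʳ-≤ 2 (*-monoʳ-≤ (suc n ^ q) (^-monoˡ-≤ q s≤n)) ⟩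
        2 * (suc n ^ q * suc n ^ q)           ≤⟨ *-mono-≤ {2} {192} {suc n ^ q * suc n ^ q} {r} (s≤s (s≤s z≤n)) power ⟩
        192 * r                               ≤⟨ *-monoʳ-≤ 192 {r} {K * r} r≤Kr ⟩
        192 * (K * r)                         ≤⟨ A-large ⟩
        # A                                   ∎

      contradictory : ⊥
      contradictory =
        let W , AW , cl , s≤ = Host.Sparse.large-clique R R-sym R-irrefl A (4 * r) n sparse no-coclique q (# high) cond₁ cond₂ (# high) ≤-refl
            f , f-inj , inside , hom = Host.Embed.embed R R-sym R-irrefl H A {D = 4 * K} sparse room W AW cl s≤ u
        in ¬copy (Colouring.extend-copy χ G v f f-inj (λ x y a → Colouring.nb⇒colour χ (hom x y a)) inside)

  arrows-G : ∀ {N} → 200 * (r * K) ≤ N → Arrows N G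
  arrows-G {N} N-large χ = decidable-stable (copy? G χ) λ ¬copy →
    -- Any vertex can serve as `u`; vertex 0 is taken, and its minority colour becomes the bad one.
    let c , small = Colouring.CopyFree.minority χ G v arrows ¬copy (Fin.fromℕ< 1≤N)
        q , q≤ , ≤q = division _ (24 * K) (m≤n⇒m≤o*n {1} {K} 24 1≤K)
    in CopyFreeLarge.contradictory χ N-large ¬copy {c = c} small {q = q} q≤ ≤q
    where
    1≤N : 1 ≤ N
    1≤N = ≤-trans (m≤n⇒m≤o*n {1} {r * K} 200 (*-mono-≤ 1≤r 1≤K)) N-large

-- The bound in terms of lower cuts

fromℕ-mono : ∀ {a b} → a ≤ b → fromℕ a ℚᵘ.≤ fromℕ b
fromℕ-mono a≤b = *≤* (ℤ.*-monoʳ-≤-nonNeg (ℤ.+ 1) (ℤ.+≤+ a≤b))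

fromℕ-* : ∀ a b → fromℕ a ℚᵘ.* fromℕ b ≡ fromℕ (a * b)
fromℕ-* a b = cong (λ z → ℚᵘ.mkℚᵘ z 0) (sym (ℤ.pos-* a b))

theorem1p3 : Σ[ C ∈ ℚᵘ ] 0ℚᵘ ℚᵘ.< C ×
    (∀ (n : ℕ) → 2 ≤ n →
    ∀ (G : Graph (suc n)) (v : Fin (suc n)) (rG rH : ℕ) →
    IsRamseyNumber G rG →
    IsRamseyNumber (deleteVertex G v) rH →
    fromℕ rG ∈ C · fromℕ rH · √ (fromℕ n · log₂ n))
theorem1p3 = fromℕ 200 , *<* (ℤ.+<+ (s≤s z≤n)) , bound
  where
  bound : ∀ n → 2 ≤ n → ∀ G v rG rH → IsRamseyNumber G rG → IsRamseyNumber (deleteVertex G v) rH →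
          fromℕ rG ∈ fromℕ 200 · fromℕ rH · √ (fromℕ n · log₂ n)
  bound n 2≤n G v rG rH (_ , minimal) (arrows , _) =
    -- `L` is the integer part of the logarithm of `n`, and `K` that of the square root of `n * L`;
    -- both are positive because `n` is at least 2.
    let L , 2^L≤n , n<2^ = bracket (2 ^_) (λ k → ^-monoʳ-< 2 (s≤s (s≤s z≤n)) (n<1+n k)) n (≤-trans (s≤s z≤n) 2≤n)
        K , K²≤ , nL< = bracket (λ k → k * k) (λ k → *-mono-< (n<1+n k) (n<1+n k)) (n * L) z≤n
        1≤L = index-positive (2 ^_) n<2^ 2≤n
        1≤K = index-positive (λ k → k * k) nL< (*-mono-≤ (≤-trans (s≤s z≤n) 2≤n) 1≤L)
        rG≤ = minimal _ (VertexDeletion.arrows-G G v arrows 2≤n 1≤L 1≤K n<2^ (<⇒≤ nL<) ≤-refl)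
    -- `K` lies below the square root, since `K * K ≤ n * L` and `L` lies below the logarithm.
    in fromℕ (rH * K) ,
       (fromℕ K ,
        inj₂ (fromℕ L , subst (2 ^ L ≤_) (sym (*-identityʳ n)) 2^L≤n ,
              subst₂ ℚᵘ._≤_ (sym (fromℕ-* K K)) (sym (fromℕ-* n L)) (fromℕ-mono K²≤)) ,
        subst (fromℕ (rH * K) ℚᵘ.≤_) (sym (fromℕ-* rH K)) (fromℕ-mono ≤-refl)) ,
       subst (fromℕ rG ℚᵘ.≤_) (sym (fromℕ-* 200 (rH * K))) (fromℕ-mono rG≤)
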